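{- Let $L$ be a multiset of odd integers greater than $1$, let $a\in\{0,1\}$, and set $\epsilon_1=7^{|L|+a-1}\big(2\max(L)+1\big)$ if $L\ne\emptyset$ and $\epsilon_1=3$ if $L=\emptyset$. Then for every $\epsilon\ge 3\epsilon_1$ there exists a graceful labeling $\Gamma_\epsilon$ of $\left[L,{}^a2\ \middle|\ \epsilon-\sum_{\ell\in L}\ell-2a\right]_\epsilon$ such that $\Delta_p\Gamma_\epsilon\supseteq\mathcal{I}(\epsilon_1+1,\epsilon)$.
   Context: $\mathcal{I}(a,b)=\{x\in\mathbb{Z}\mid a\le x\le b\}$; $|L|$ counts multiplicity. $[L,{}^a2\mid m]$ is the vertex-disjoint union of one $\ell$-cycle for each $\ell\in L$, $a$ cycles of length $2$ (two vertices joined by two parallel edges), and a path with $m$ edges; the subscript $\epsilon$ is the number of edges. A labeling is an isomorphic copy with distinct integer vertices; $\Delta\Gamma$ is the multiset of differences $u-w$ over ordered pairs of adjacent vertices (parallel edges counted separately), and $\Delta_p\Gamma$ is the same restricted to edges of the path. A graceful labeling of such a graph with $\epsilon$ edges is a labeling $\Gamma$ with vertex set $\mathcal{I}(0,\epsilon)$ such that $\Delta\Gamma=\pm\mathcal{I}(1,\epsilon)$ if there is no $2$-cycle, and $\Delta\Gamma=\pm\{1,3,3\}\cup\pm\mathcal{I}(4,\epsilon)$ (as multisets) if there is exactly one $2$-cycle. -}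

module Defs where

open import Data.Nat as ℕ using (ℕ; zero; suc; _∸_; _⊔_; _^_)
open import Data.Integer as ℤ using (ℤ; +_)
open import Data.List using (List; []; _∷_; _++_; map; concat; concatMap; length; upTo; foldr; [_])
open import Data.List.Relation.Binary.Permutation.Propositional using (_↭_)
open import Data.List.Relation.Binary.Pointwise using (Pointwise)
open import Data.Product using (_×_; _,_; ∃)
open import Relation.Binary.PropositionalEquality using (_≡_)

I : ℕ → ℕ → List ℤ
I a b = map (λ k → + (a ℕ.+ k)) (upTo (suc b ∸ a))

± : List ℤ → List ℤ
± = concatMap (λ x → x ∷ ℤ.- x ∷ [])

pathEdges : List ℤ → List (ℤ × ℤ)
pathEdges []           = []
pathEdges (x ∷ [])     = []
pathEdges (x ∷ y ∷ r)  = (x , y) ∷ pathEdges (y ∷ r)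

cycleEdges : List ℤ → List (ℤ × ℤ)
cycleEdges []       = []
cycleEdges (v ∷ vs) = pathEdges (v ∷ vs ++ [ v ])

-- a 2-cycle {u,w}: two parallel edges
twoEdges : ℤ × ℤ → List (ℤ × ℤ)
twoEdges e = e ∷ e ∷ []

Δedges : List (ℤ × ℤ) → List ℤ
Δedges = concatMap (λ { (u , w) → (u ℤ.- w) ∷ (w ℤ.- u) ∷ [] })

-- A labeling of [L, ^a 2 | m]: an isomorphic copy with integer vertices.
-- Distinctness of all vertices is enforced by the gracefulness condition
-- (vertex list is a permutation of 𝓘(0,ε)).
record Labeling (L : List ℕ) (a m : ℕ) : Set where
  field
    cycles    : List (List ℤ)
    cycle-len : Pointwise (λ ℓ c → length c ≡ ℓ) L cycles
    twos      : List (ℤ × ℤ)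
    twos-len  : length twos ≡ a
    path      : List ℤ
    path-len  : length path ≡ suc m

  vertices : List ℤ
  vertices = concat cycles ++ concatMap (λ { (u , w) → u ∷ w ∷ [] }) twos ++ path

  Δ : List ℤ
  Δ = Δedges (concatMap cycleEdges cycles ++ concatMap twoEdges twos ++ pathEdges path)

  Δp : List ℤ
  Δp = Δedges (pathEdges path)

gracefulTarget : ℕ → ℕ → List ℤ
gracefulTarget zero          ε = ± (I 1 ε)
gracefulTarget (suc zero)    ε = ± (+ 1 ∷ + 3 ∷ + 3 ∷ []) ++ ± (I 4 ε)
gracefulTarget (suc (suc _)) ε = []   -- not used (a ∈ {0,1})

Graceful : ∀ {L a m} → ℕ → Labeling L a m → Set
Graceful {L} {a} {m} ε Γ =
  (Labeling.vertices Γ ↭ I 0 ε) × (Labeling.Δ Γ ↭ gracefulTarget a ε)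

_⊇ₘ_ : List ℤ → List ℤ → Set
X ⊇ₘ Y = ∃ λ R → X ↭ Y ++ R

maxL : List ℕ → ℕ
maxL = foldr _⊔_ 0

ε₁ : List ℕ → ℕ → ℕ
ε₁ []         a = 3
ε₁ L@(_ ∷ _) a = 7 ^ (length L ℕ.+ a ∸ 1) ℕ.* (2 ℕ.* maxL L ℕ.+ 1)

{-# OPTIONS --safe #-}

-- A labeling on {0,…,N} whose path has an end at g is enlarged by new labels on both sides and new
-- edge lengths N+1, N+2, …: the path jumps from g across the interval and then alternates between
-- the low and the high new labels. Counting edge lengths with sign forces the new end of the path to
-- be again at distance g from the boundary; a Euclidean recursion produces such paths
-- for every number q ≥ 2g+1 of new labels except q = 4g+1. When N is tuned to N = 6g + 3 - 5j by this,
-- a cycle of length 2j+3 with one edge between two low labels can be inserted at the same time,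
-- giving N′ = 22g + 18 - 11j and g′ = 7g + 5 - 3j; this is the factor 7 in ε₁. The recursion
-- starts with the longest cycle wound around a path, or with a 2-cycle on few labels.
module Submission where

open import Defs
open import Data.Nat
open import Data.Nat.Properties
open import Data.Nat.Tactic.RingSolver using (solve-∀)
open import Data.Nat.Divisibility using (_∣_; divides)
open import Data.Nat.ListAction using (sum)
open import Data.Integer as ℤ using (ℤ; +_)
import Data.Integer.Properties as ℤ
open import Data.List using (List; []; _∷_; _++_; map; length; [_]; concat; concatMap; upTo; applyUpTo)
open import Data.List.Properties using (map-++; ++-identityʳ; ++-assoc; length-map; length-++; map-upTo)
open import Data.List.Relation.Unary.All using (All; []; _∷_)
import Data.List.Relation.Unary.All as All
open import Data.List.Relation.Unary.All.Properties using (++⁻; ++⁻ˡ; ++⁻ʳ; ++⁺)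
open import Data.List.Relation.Unary.Any using (here)
open import Data.List.Membership.Propositional.Properties using (∈-++⁻; ∈-∃++)
open import Data.List.Relation.Binary.Pointwise using (Pointwise; []; _∷_)
open import Data.List.Relation.Binary.Permutation.Propositional
  using (_↭_; prep; swap; ↭-refl; ↭-sym; ↭-trans; ↭-reflexive)
import Data.List.Relation.Binary.Permutation.Propositional as Perm
open import Data.List.Relation.Binary.Permutation.Propositional.Properties
  using (++-comm; shift; map⁺; ++-commutativeMonoid; All-resp-↭; ↭-length; ++⁺ˡ; ++⁺ʳ; drop-∷; ∈-resp-↭)
  renaming (++⁺ to ++-cong)
open import Data.Product using (Σ; _×_; _,_; ∃; ∃₂; proj₁; proj₂)
open import Data.Sum using (_⊎_; inj₁; inj₂)
open import Relation.Nullary using (¬_; contradiction; yes; no)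
open import Relation.Binary.PropositionalEquality hiding ([_]; J)
open import Algebra.Solver.CommutativeMonoid (++-commutativeMonoid {A = ℕ})
  using (_⊕_; _⊜_) renaming (solve to ↭-solve)

-- The signed count: let a path alternate between T+1 low labels from l and T+1 high labels from h =
-- l+T+e, starting high, ending low and using the lengths e,...,e+2T. These lengths add up to twice
-- the difference of the two label sums, minus the start, plus the end. This gives start - end = h -
-- l, so both ends have the same offset in their blocks. With T+1 low labels, T high ones and 2T
-- lengths, both ends are low and their offsets add up to T. For T = 2g > 0 the offset g would make
-- the two ends coincide: this is the exception q = 4g+1. An odd cycle cannot alternate between low
-- and high labels, whence its edge inside the low side. Its insertion needs j ≤ g, so the longest
-- cycle has to be placed before the others. Old labels are only shifted or reflected, which keeps
-- all old edge lengths, and only one end of the path is ever prolonged.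

private variable
  a d n p u w x y z δ κ ℓ B M X : ℕ
  D D′ DQ DX L L′ V V′ VQ VX : List ℕ

-- Ranges, walks and zigzags

rng : ℕ → ℕ → List ℕ
rng a zero    = []
rng a (suc n) = a ∷ rng (suc a) n

rng-∷ʳ : ∀ a n → rng a (suc n) ↭ a + n ∷ rng a n
rng-∷ʳ a zero    = ↭-reflexive (cong (_∷ []) (sym (+-identityʳ a)))
rng-∷ʳ a (suc n) = ↭-trans (prep a (rng-∷ʳ (suc a) n))
  (↭-trans (↭-reflexive (cong (λ b → a ∷ b ∷ rng (suc a) n) (sym (+-suc a n)))) (swap _ _ ↭-refl))

rng-++ : ∀ {a b} m n → b ≡ a + m → rng a m ++ rng b n ≡ rng a (m + n)
rng-++ {a} zero    n refl = cong (λ b → rng b n) (+-identityʳ a)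
rng-++ {a} (suc m) n refl = cong (a ∷_) (rng-++ m n (+-suc a m))

length-rng : ∀ a n → length (rng a n) ≡ n
length-rng a zero    = refl
length-rng a (suc n) = cong suc (length-rng (suc a) n)

rng-≤ : ∀ a n {b} → a + n ≤ suc b → All (_≤ b) (rng a n)
rng-≤ a zero    _ = []
rng-≤ a (suc n) h =
  ≤-trans (m≤m+n a n) (s≤s⁻¹ h′) ∷ rng-≤ (suc a) n h′
  where h′ = ≤-trans (≤-reflexive (sym (+-suc a n))) h

-- With the distance expressed by addition, every edge of an explicit construction becomes a linear
-- identity, and the constructor records which endpoint is larger.
Dist : ℕ → ℕ → ℕ → Set
Dist x y d = x + d ≡ y ⊎ y + d ≡ x

Dist-sym : Dist x y d → Dist y x d
Dist-sym (inj₁ e) = inj₂ e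
Dist-sym (inj₂ e) = inj₁ e

-- Walk lists vertices and edge lengths in order, Path only up to permutation.
data Walk : ℕ → ℕ → List ℕ → List ℕ → Set where
  pt   : ∀ x → Walk x x [ x ] []
  cons : Dist x y d → Walk y z V D → Walk x z (x ∷ V) (d ∷ D)

Path : ℕ → ℕ → List ℕ → List ℕ → Set
Path x y V D = ∃₂ λ V′ D′ → Walk x y V′ D′ × V′ ↭ V × D′ ↭ D

point : ∀ x → Path x x [ x ] []
point x = _ , _ , pt x , ↭-refl , ↭-refl

ends : x ≡ z → y ≡ w → Path x y V D → Path z w V D
ends refl refl p = p

_◂_ : Dist x y d → Path y z V D → Path x z (x ∷ V) (d ∷ D)
δ ◂ (_ , _ , s , v , e) = _ , _ , cons δ s , prep _ v , prep _ e

reperm : V ↭ V′ → D ↭ D′ → Path x y V D → Path x y V′ D′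
reperm v e (_ , _ , s , v′ , e′) = _ , _ , s , ↭-trans v′ v , ↭-trans e′ e

Walk-join : Walk x y V D → Dist y z d → Walk z w V′ D′ → Walk x w (V ++ V′) (D ++ d ∷ D′)
Walk-join (pt _)     δ t = cons δ t
Walk-join (cons ε s) δ t = cons ε (Walk-join s δ t)

join : Path x y V D → Dist y z d → Path z w V′ D′ → Path x w (V ++ V′) (D ++ d ∷ D′)
join (_ , _ , s , v , e) δ (_ , _ , s′ , v′ , e′) =
  _ , _ , Walk-join s δ s′ , ++-cong v v′ , ++-cong e (prep _ e′)

Walk-rev : Walk x y V D → Path y x V D
Walk-rev (pt x)     = point x
Walk-rev {V = x ∷ V} {d ∷ D} (cons δ s) =
  reperm (++-comm V [ x ]) (++-comm D [ d ]) (join (Walk-rev s) (Dist-sym δ) (point x))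

rev : Path x y V D → Path y x V D
rev (_ , _ , s , v , e) = reperm v e (Walk-rev s)

-- `P` is there for the reflection `c ∸_`, which preserves distances only between labels at most
-- `c`.
Walk-map : ∀ {P : ℕ → Set} (φ : ℕ → ℕ) → (∀ {x y d} → P x → P y → Dist x y d → Dist (φ x) (φ y) d) →
           Walk x y V D → All P V → Walk (φ x) (φ y) (map φ V) D
Walk-map φ f (pt _) _ = pt _
Walk-map φ f (cons δ s@(pt _))     (p ∷ q ∷ ps) = cons (f p q δ) (Walk-map φ f s (q ∷ ps))
Walk-map φ f (cons δ s@(cons _ _)) (p ∷ q ∷ ps) = cons (f p q δ) (Walk-map φ f s (q ∷ ps))

Dist-shift : ∀ s → Dist x y d → Dist (s + x) (s + y) d
Dist-shift s (inj₁ refl) = inj₁ (+-assoc s _ _)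
Dist-shift s (inj₂ refl) = inj₂ (+-assoc s _ _)

∸-reflect : ∀ c x d → x + d ≤ c → c ∸ (x + d) + d ≡ c ∸ x
∸-reflect c x d h = begin
  c ∸ (x + d) + d      ≡⟨ cong (_+ d) (∸-+-assoc c x d) ⟨
  (c ∸ x) ∸ d + d      ≡⟨ m∸n+n≡m (subst (_≤ c ∸ x) (m+n∸m≡n x d) (∸-monoˡ-≤ x h)) ⟩
  c ∸ x                ∎
  where open ≡-Reasoning

Dist-mirror : ∀ c → x ≤ c → y ≤ c → Dist x y d → Dist (c ∸ x) (c ∸ y) d
Dist-mirror {x} {y} {d} c p q (inj₁ refl) = inj₂ (∸-reflect c x d q)
Dist-mirror {x} {y} {d} c p q (inj₂ refl) = inj₁ (∸-reflect c y d p)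

shift-rng : ∀ s a n → map (_+_ s) (rng a n) ≡ rng (s + a) n
shift-rng s a zero    = refl
shift-rng s a (suc n) = cong (s + a ∷_) (trans (shift-rng s (suc a) n) (cong (λ b → rng b n) (+-suc s a)))

mirror-rng : ∀ a n b {c} → a + n + b ≡ suc c → map (c ∸_) (rng a n) ↭ rng b n
mirror-rng a zero    b h = ↭-refl
mirror-rng a (suc n) b {c} h = ↭-trans
  (↭-trans (prep (c ∸ a) (mirror-rng (suc a) n b (trans (cong (_+ b) (sym (+-suc a n))) h)))
           (↭-reflexive (cong (_∷ rng b n) c∸a≡b+n)))
  (↭-sym (rng-∷ʳ b n))
  where
  c∸a≡b+n : c ∸ a ≡ b + n
  c∸a≡b+n = trans (cong (_∸ a) (sym (suc-injective (trans (lem a n b) h)))) (m+n∸m≡n a (b + n))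
    where
    lem : ∀ a n b → suc (a + (b + n)) ≡ a + suc n + b
    lem = solve-∀

mirror : ∀ c → All (_≤ c) V → Path x y V D → Path (c ∸ x) (c ∸ y) (map (c ∸_) V) D
mirror c ps (_ , _ , s , v , e) =
  _ , _ , Walk-map (c ∸_) (Dist-mirror c) s (All-resp-↭ (↭-sym v) ps) , map⁺ (c ∸_) v , e

shiftP : ∀ s → Path x y V D → Path (s + x) (s + y) (map (_+_ s) V) D
shiftP s (_ , _ , w , v , e) =
  _ , _ , Walk-map {P = λ _ → ℕ} (_+_ s) (λ _ _ → Dist-shift s) w (All.universal (λ x → x) _) , map⁺ (_+_ s) v , e

rng-outer : ∀ l m h n → l ∷ h + n ∷ rng (suc l) m ++ rng h n ↭ rng l (suc m) ++ rng h (suc n)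
rng-outer l m h n = prep l (↭-trans (↭-sym (shift (h + n) (rng (suc l) m) (rng h n)))
  (++⁺ˡ (rng (suc l) m) (↭-sym (rng-∷ʳ h n))))

rng-top₂ : ∀ e n → e + suc n ∷ e + n ∷ rng e n ↭ rng e (2 + n)
rng-top₂ e n = ↭-sym (↭-trans (rng-∷ʳ e (suc n)) (prep _ (rng-∷ʳ e n)))

-- Zigzags between the blocks starting at l and h; e is the length of the innermost edge.
zigL : ∀ t l h e → h ≡ l + t + e → Path l h (rng l (suc t) ++ rng h (suc t)) (rng e (suc (t * 2)))
zigL zero    l h e eq = inj₁ (trans (cong (_+ e) (sym (+-identityʳ l))) (sym eq)) ◂ point h
zigL (suc t) l h e refl = reperm (rng-outer l (suc t) h (suc t)) (rng-top₂ e _)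
  (inj₁ (lem₁ l t e) ◂ (inj₂ (lem₂ l t e) ◂ zigL t (suc l) _ e (cong (_+ e) (+-suc l t))))
  where
  lem₁ : ∀ l t e → l + (e + (2 + t * 2)) ≡ l + suc t + e + suc t
  lem₁ = solve-∀
  lem₂ : ∀ l t e → suc l + (e + (1 + t * 2)) ≡ l + suc t + e + suc t
  lem₂ = solve-∀

zigH : ∀ t l h e → h ≡ l + t + e →
       Path (h + t) (l + t) (rng l (suc t) ++ rng h (suc t)) (rng e (suc (t * 2)))
zigH zero    l h e eq = reperm (swap _ _ ↭-refl) ↭-refl
  (ends (sym (+-identityʳ h)) (sym (+-identityʳ l))
    (inj₂ (trans (cong (_+ e) (sym (+-identityʳ l))) (sym eq)) ◂ point l))
zigH (suc t) l h e refl = reperm (↭-trans (swap _ _ ↭-refl) (rng-outer l (suc t) h (suc t))) (rng-top₂ e _)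
  (inj₂ (lem₁ l t e) ◂ (inj₁ (lem₂ l t e) ◂
    ends refl (sym (+-suc l t)) (zigH t (suc l) _ e (cong (_+ e) (+-suc l t)))))
  where
  lem₁ : ∀ l t e → l + (e + (2 + t * 2)) ≡ l + suc t + e + suc t
  lem₁ = solve-∀
  lem₂ : ∀ l t e → l + (e + (1 + t * 2)) ≡ l + suc t + e + t
  lem₂ = solve-∀

zigLL : ∀ t l h e → h ≡ l + t + e → Path l (l + t) (rng l (suc t) ++ rng h t) (rng e (t * 2))
zigLL zero    l h e eq = ends refl (sym (+-identityʳ l)) (point l)
zigLL (suc t) l h e refl = reperm (rng-outer l (suc t) h t) (rng-top₂ e _)
  (inj₁ (lem₁ l t e) ◂ (inj₂ (lem₂ l t e) ◂
    ends refl (sym (+-suc l t)) (zigLL t (suc l) _ e (cong (_+ e) (+-suc l t)))))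
  where
  lem₁ : ∀ l t e → l + (e + suc (t * 2)) ≡ l + suc t + e + t
  lem₁ = solve-∀
  lem₂ : ∀ l t e → suc l + (e + t * 2) ≡ l + suc t + e + t
  lem₂ = solve-∀

zigHH : ∀ t l h e → suc h ≡ l + t + e → Path (h + t) h (rng l t ++ rng h (suc t)) (rng e (t * 2))
zigHH zero    l h e eq = ends (sym (+-identityʳ h)) refl (point h)
zigHH (suc t) l h e eq = reperm (↭-trans (swap _ _ ↭-refl) (rng-outer l t h (suc t))) (rng-top₂ e _)
  (inj₂ (trans (lem₁ l t e) (sym eq′)) ◂ (inj₁ (trans (lem₂ l t e) (cong (_+ t) h≡)) ◂
     zigHH t (suc l) h e (trans eq (cong (_+ e) (+-suc l t)))))
  where
  h≡ : l + t + e ≡ h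
  h≡ = suc-injective (trans (cong (_+ e) (sym (+-suc l t))) (sym eq))
  eq′ : h + suc t ≡ l + t + e + suc t
  eq′ = cong (_+ suc t) (sym h≡)
  lem₁ : ∀ l t e → l + (e + suc (t * 2)) ≡ l + t + e + suc t
  lem₁ = solve-∀
  lem₂ : ∀ l t e → l + (e + t * 2) ≡ l + t + e + t
  lem₂ = solve-∀

-- Bipartite paths between two blocks of labels

-- The path starts at distance f from the top of the high block and ends at distance d from the
-- bottom of the low block; e is the length of the innermost edge.
Even : ℕ → ℕ → Set
Even f d = ∀ l h e → h ≡ l + f + d + e →
  Path (h + d) (l + d) (rng l (suc (f + d)) ++ rng h (suc (f + d))) (rng e (suc ((f + d) * 2)))

-- The outermost d + 1 labels of each block are left for a final zigzag ending at l + d.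
Even-peel : ∀ k d → Even k d → Even (suc (d + k)) d
Even-peel k d E l h e refl = reperm
  (↭-trans
    (↭-solve 4 (λ a b c d → (a ⊕ b) ⊕ (c ⊕ d) ⊜ (c ⊕ a) ⊕ (b ⊕ d)) ↭-refl
      (rng (l + suc d) (suc (k + d))) (rng h (suc (k + d))) (rng l (suc d)) (rng h₂ (suc d)))
    (↭-reflexive (cong₂ _++_
      (trans (rng-++ (suc d) (suc (k + d)) refl) (cong (rng l) (cnt₁ d k)))
      (trans (rng-++ (suc (k + d)) (suc d) refl) (cong (rng h) (cnt₂ d k))))))
  (↭-reflexive (trans (cong (λ b → rng e (suc ((k + d) * 2)) ++ e + suc ((k + d) * 2) ∷ rng b (suc (d * 2))) (e₂ e k d))
    (trans (rng-++ (suc ((k + d) * 2)) (suc (suc (d * 2))) refl) (cong (rng e) (cnt₃ d k)))))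
  (join (E (l + suc d) h e (h₁ l d k e)) (inj₁ (jmp l d k e)) (zigH d l h₂ (e + suc (k + d) * 2) (h₂-eq l d k e)))
  where
  h₂ = h + suc (k + d)
  cnt₁ : ∀ d k → suc d + suc (k + d) ≡ suc (suc (d + k) + d)
  cnt₁ = solve-∀
  cnt₂ : ∀ d k → suc (k + d) + suc d ≡ suc (suc (d + k) + d)
  cnt₂ = solve-∀
  cnt₃ : ∀ d k → suc ((k + d) * 2) + suc (suc (d * 2)) ≡ suc ((suc (d + k) + d) * 2)
  cnt₃ = solve-∀
  e₂ : ∀ e k d → e + suc (k + d) * 2 ≡ suc (e + suc ((k + d) * 2))
  e₂ = solve-∀
  h₁ : ∀ l d k e → l + suc (d + k) + d + e ≡ l + suc d + k + d + e
  h₁ = solve-∀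
  jmp : ∀ l d k e → l + suc d + d + (e + suc ((k + d) * 2)) ≡ l + suc (d + k) + d + e + suc (k + d) + d
  jmp = solve-∀
  h₂-eq : ∀ l d k e → l + suc (d + k) + d + e + suc (k + d) ≡ l + d + (e + suc (k + d) * 2)
  h₂-eq = solve-∀

m≡a+b⇒m∸a≡b : ∀ {c} a b → c ≡ a + b → c ∸ a ≡ b
m≡a+b⇒m∸a≡b a b refl = m+n∸m≡n a b

-- The reflection exchanging the two blocks also exchanges the types of the two ends, so the path is
-- reversed to start in the high block again.
Even-mirror : ∀ f d → Even d f → Even f d
Even-mirror f d E l h e refl = reperm
  (↭-trans (↭-reflexive (map-++ (c ∸_) (rng l (suc (d + f))) (rng h (suc (d + f)))))
  (↭-trans (++-cong (mirror-rng l (suc (d + f)) h (c₁ l f d h)) (mirror-rng h (suc (d + f)) l (c₂ l f d h)))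
  (↭-trans (++-comm (rng h (suc (d + f))) (rng l (suc (d + f))))
  (↭-reflexive (cong (λ k → rng l (suc k) ++ rng h (suc k)) (+-comm d f))))))
  (↭-reflexive (cong (λ k → rng e (suc (k * 2))) (+-comm d f)))
  (ends (m≡a+b⇒m∸a≡b (l + f) _ (c₃ l f d h)) (m≡a+b⇒m∸a≡b (h + f) _ (c₄ l f d h))
    (rev (mirror c (++⁺ (rng-≤ l (suc (d + f)) (bnd l f d h)) (rng-≤ h (suc (d + f)) (bnd′ l f d h)))
      (E l h e (cong (_+ e) (flip l f d))))))
  where
  c = l + f + d + h
  flip : ∀ l f d → l + f + d ≡ l + d + f
  flip = solve-∀
  c₁ : ∀ l f d h → l + suc (d + f) + h ≡ suc (l + f + d + h)
  c₁ = solve-∀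
  c₂ : ∀ l f d h → h + suc (d + f) + l ≡ suc (l + f + d + h)
  c₂ = solve-∀
  c₃ : ∀ l f d h → l + f + d + h ≡ l + f + (h + d)
  c₃ = solve-∀
  c₄ : ∀ l f d h → l + f + d + h ≡ h + f + (l + d)
  c₄ = solve-∀
  bnd : ∀ l f d h → l + suc (d + f) ≤ suc (l + f + d + h)
  bnd l f d h = subst (l + suc (d + f) ≤_) (c₁ l f d h) (m≤m+n _ h)
  bnd′ : ∀ l f d h → h + suc (d + f) ≤ suc (l + f + d + h)
  bnd′ l f d h = subst (h + suc (d + f) ≤_) (c₂ l f d h) (m≤m+n _ l)

-- Both ends are centres of their blocks. The upper half of the high block is paired with the low
-- labels below the centre, using the long lengths; the rest uses the short ones. The middle length
-- `e + d * 2` equals h - l and joins the tops of the two blocks.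
Even-diag : ∀ d → Even d d
Even-diag d l h e refl = reperm
  (↭-trans
    (↭-solve 4 (λ a b c d → (a ⊕ b) ⊕ (c ⊕ d) ⊜ (a ⊕ c) ⊕ (d ⊕ b)) ↭-refl
      (rng l d) (rng (h + d) (suc d)) (rng (l + d) (suc d)) (rng h d))
    (↭-reflexive (cong₂ _++_
      (trans (rng-++ d (suc d) refl) (cong (rng l) (+-suc d d)))
      (trans (rng-++ d (suc d) refl) (cong (rng h) (+-suc d d))))))
  (↭-trans
    (↭-solve 3 (λ a b c → a ⊕ b ⊕ c ⊜ c ⊕ b ⊕ a) ↭-refl (rng (suc (e + d * 2)) (d * 2)) [ e + d * 2 ] (rng e (d * 2)))
    (↭-reflexive (trans (rng-++ (d * 2) (suc (d * 2)) refl) (cong (rng e) (cnt d)))))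
  (join (rev (zigHH d l (h + d) (suc (e + d * 2)) (h₂ l d e))) (inj₂ (jmp l d e)) (rev (zigLL d (l + d) h e refl)))
  where
  cnt : ∀ d → d * 2 + suc (d * 2) ≡ suc ((d + d) * 2)
  cnt = solve-∀
  h₂ : ∀ l d e → suc (l + d + d + e + d) ≡ l + d + suc (e + d * 2)
  h₂ = solve-∀
  jmp : ∀ l d e → l + d + d + (e + d * 2) ≡ l + d + d + e + d + d
  jmp = solve-∀

even-rec : ∀ n f d → f + d ≤ n → Even f d
even-rec n f d h with compare f d
even-rec n f .f h | equal .f = Even-diag f
even-rec (suc n) f .(suc (f + k)) h | less .f k =
  Even-mirror f _ (Even-peel k f (even-rec n k f (≤-trans (≤-trans (≤-reflexive (+-comm k f)) (m≤n+m (f + k) f))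
    (s≤s⁻¹ (≤-trans (≤-reflexive (sym (+-suc f (f + k)))) h)))))
even-rec zero zero (suc _) () | less .zero k
even-rec zero (suc f) d () | less _ k
even-rec (suc n) .(suc (d + k)) d h | greater .d k =
  Even-peel k d (even-rec n k d (≤-trans (+-monoˡ-≤ d (m≤n+m k d)) (s≤s⁻¹ h)))

even : ∀ f d → Even f d
even f d = even-rec _ f d ≤-refl

-- Here the low block is larger by one and contains both ends, so f = d is impossible unless f = d = 0.
Odd : ℕ → ℕ → Set
Odd f d = ∀ l h e → h ≡ l + f + d + e →
  Path (l + f) (l + d) (rng l (suc (f + d)) ++ rng h (f + d)) (rng e ((f + d) * 2))

-- A final zigzag through `d + 1` low and `d` high outer labels absorbs the surplus low label, and
-- what remains is a balanced pair for `even`.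
odd-> : ∀ k d → Odd (suc (d + k)) d
odd-> k d l h e refl = reperm
  (↭-trans
    (↭-solve 4 (λ a b c d → (a ⊕ b) ⊕ (c ⊕ d) ⊜ (c ⊕ a) ⊕ (b ⊕ d)) ↭-refl
      (rng (l + suc d) (suc (d + k))) (rng h (suc (d + k))) (rng l (suc d)) (rng h₂ d))
    (↭-reflexive (cong₂ _++_
      (trans (rng-++ (suc d) (suc (d + k)) refl) (cong (rng l) (cnt₁ d k)))
      (rng-++ (suc (d + k)) d refl))))
  (↭-reflexive (trans (cong (λ b → rng e (suc ((d + k) * 2)) ++ e + suc ((d + k) * 2) ∷ rng b (d * 2)) (e₂ e k d))
    (trans (rng-++ (suc ((d + k) * 2)) (suc (d * 2)) refl) (cong (rng e) (cnt₃ d k)))))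
  (ends (st l d k) refl
    (join (rev (even d k (l + suc d) h e (h₁ l d k e))) (inj₂ (jmp l d k e)) (zigLL d l h₂ (e + suc (d + k) * 2) (h₂-eq l d k e))))
  where
  h₂ = h + suc (d + k)
  st : ∀ l d k → l + suc d + k ≡ l + suc (d + k)
  st = solve-∀
  cnt₁ : ∀ d k → suc d + suc (d + k) ≡ suc (suc (d + k) + d)
  cnt₁ = solve-∀
  cnt₃ : ∀ d k → suc ((d + k) * 2) + suc (d * 2) ≡ (suc (d + k) + d) * 2
  cnt₃ = solve-∀
  e₂ : ∀ e k d → e + suc (d + k) * 2 ≡ suc (e + suc ((d + k) * 2))
  e₂ = solve-∀
  h₁ : ∀ l d k e → l + suc (d + k) + d + e ≡ l + suc d + d + k + e
  h₁ = solve-∀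
  jmp : ∀ l d k e → l + (e + suc ((d + k) * 2)) ≡ l + suc (d + k) + d + e + k
  jmp = solve-∀
  h₂-eq : ∀ l d k e → l + suc (d + k) + d + e + suc (d + k) ≡ l + d + (e + suc (d + k) * 2)
  h₂-eq = solve-∀

odd : ∀ f d → f ≢ d → Odd f d
odd f d f≢d l h e eq with compare f d
... | equal _     = contradiction refl f≢d
... | greater _ k = odd-> k d l h e eq
... | less _ k    = rev (subst (λ t → Path (l + d) (l + f) (rng l (suc t) ++ rng h t) (rng e (t * 2))) (+-comm d f)
    (odd-> k f l h e (trans eq (cong (_+ e) (flip l f d)))))
  where
  flip : ∀ l f d → l + f + d ≡ l + d + f
  flip = solve-∀

-- Labelings and their enlargement

data Core : List ℕ → ℕ → List ℕ → List ℕ → Set where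
  none : Core [] 0 [] []
  two  : Dist u w d → Core [] 1 (u ∷ w ∷ []) (d ∷ d ∷ [])
  cyc  : Walk x y V D → Dist y x κ → length V ≡ ℓ → Core L a V′ D′ →
         Core (ℓ ∷ L) a (V ++ V′) (κ ∷ D ++ D′)

Walk-ends : ∀ {P : ℕ → Set} → Walk x y V D → All P V → P x × P y
Walk-ends (pt _)     (p ∷ _)  = p , p
Walk-ends (cons _ w) (p ∷ ps) = p , proj₂ (Walk-ends w ps)

Core-map : ∀ {P : ℕ → Set} (φ : ℕ → ℕ) → (∀ {x y d} → P x → P y → Dist x y d → Dist (φ x) (φ y) d) →
           Core L a V D → All P V → Core L a (map φ V) D
Core-map φ f none _ = none
Core-map φ f (two δ) (p ∷ q ∷ _) = two (f p q δ)
Core-map φ f (cyc {V = V} {V′ = V′} w δ len C) ps =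
  subst (λ W → Core _ _ W _) (sym (map-++ φ V V′))
    (cyc (Walk-map φ f w ps₁) (f (proj₂ es) (proj₁ es) δ) (trans (length-map φ V) len) (Core-map φ f C (++⁻ʳ V ps)))
  where
  ps₁ = ++⁻ˡ V ps
  es = Walk-ends w ps₁

base : ℕ → List ℕ
base zero    = 1 ∷ 2 ∷ 3 ∷ []
base (suc _) = 1 ∷ 3 ∷ 3 ∷ []

-- A graceful labeling with ε = 3 + n, so that the lengths are base a and 4,…,ε; B bounds the
-- lengths in the cycles and p is one end of the path.
record State (L : List ℕ) (a B n p : ℕ) : Set where
  constructor state
  field
    {VC DC VP DP} : List ℕ
    {q}   : ℕ
    core  : Core L a VC DC
    path  : Path p q VP DP
    verts : VC ++ VP ↭ rng 0 (4 + n)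
    diffs : DC ++ DP ↭ base a ++ rng 4 n
    bound : All (_≤ B) DC

verts-≤ : ∀ V {W n} → V ++ W ↭ rng 0 (suc n) → All (_≤ n) V × All (_≤ n) W
verts-≤ V e = ++⁻ V (All-resp-↭ (↭-sym e) (rng-≤ 0 _ ≤-refl))

mirrorS : ∀ p′ → p + p′ ≡ 3 + n → State L a B n p → State L a B n p′
mirrorS {p = p} {n = n} p′ eq (state {VC} {DC} {VP} C P v e b) = state
  (Core-map (N ∸_) (Dist-mirror N) C (proj₁ le))
  (ends (m≡a+b⇒m∸a≡b p p′ (sym eq)) refl (mirror N (proj₂ le) P))
  (↭-trans (↭-reflexive (sym (map-++ (N ∸_) VC VP))) (↭-trans (map⁺ (N ∸_) v)
    (mirror-rng 0 (4 + n) 0 (+-identityʳ (4 + n)))))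
  e b
  where
  N = 3 + n
  le = verts-≤ VC v

relabel : ∀ {n p n′ p′} → n ≡ n′ → p ≡ p′ → State L a B n p → State L a B n′ p′
relabel refl refl S = S

widen : ∀ {B′} → B ≤ B′ → State L a B n p → State L a B′ n p
widen B≤B′ (state C P v e b) = state C P v e (All.map (λ h → ≤-trans h B≤B′) b)

-- VX and DX belong to the added cycle, VQ and DQ to the added part of the path, which is joined to
-- the old end p by an edge of length δ.
grow : ∀ s m → (∀ {V D} → Core L a V D → Core L′ a (VX ++ V) (DX ++ D)) → All (_≤ B) DX →
       State L a B n p → Path y z VQ DQ → Dist z (s + p) δ →
       VX ++ VQ ↭ rng 0 s ++ rng (s + (4 + n)) m → DX ++ DQ ++ [ δ ] ↭ rng (4 + n) (s + m) →
       State L′ a B (n + (s + m)) y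
grow {a = a} {VX = VX} {DX = DX} {n = n} {VQ = VQ} {DQ = DQ} {δ = δ} s m f bY (state {VC} {DC} {VP} {DP} C P v e b) Q δ-eq vQ eQ = state
  (f (Core-map {P = λ _ → ℕ} (_+_ s) (λ _ _ → Dist-shift s) C (All.universal (λ x → x) _)))
  (join Q δ-eq (shiftP s P))
  (↭-trans (↭-solve 4 (λ a b c d → (a ⊕ b) ⊕ (c ⊕ d) ⊜ (a ⊕ c) ⊕ (b ⊕ d)) ↭-refl VX (map (_+_ s) VC) VQ (map (_+_ s) VP))
    (↭-trans (++-cong vQ (↭-trans (↭-reflexive (sym (map-++ (_+_ s) VC VP)))
                         (↭-trans (map⁺ (_+_ s) v) (↭-reflexive (shift-rng s 0 (4 + n))))))
    (↭-trans (↭-solve 3 (λ a b c → (a ⊕ b) ⊕ c ⊜ a ⊕ (c ⊕ b)) ↭-refl (rng 0 s) (rng (s + (4 + n)) m) (rng (s + 0) (4 + n)))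
    (↭-reflexive (trans
      (cong (rng 0 s ++_) (rng-++ (4 + n) m (cong (_+ (4 + n)) (sym (+-identityʳ s)))))
      (trans (rng-++ s (4 + n + m) (+-identityʳ s)) (cong (rng 0) (cnt s n m))))))))
  (↭-trans (↭-solve 5 (λ a b c d e → (a ⊕ b) ⊕ (c ⊕ d ⊕ e) ⊜ (b ⊕ e) ⊕ (a ⊕ c ⊕ d)) ↭-refl DX DC DQ [ δ ] DP)
    (↭-trans (++-cong e eQ)
    (↭-trans (↭-solve 3 (λ a b c → (a ⊕ b) ⊕ c ⊜ a ⊕ (b ⊕ c)) ↭-refl (base a) (rng 4 n) (rng (4 + n) (s + m)))
    (↭-reflexive (cong (base a ++_) (rng-++ n (s + m) refl))))))
  (++⁺ bY b)
  where
  cnt : ∀ s n m → s + (4 + n + m) ≡ 4 + (n + (s + m))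
  cnt = solve-∀

-- The new length 4 + n takes the end g across the interval to the (g+1)-st new label on the other
-- side; the remaining new labels and lengths are those of even or odd.
extend-even : ∀ f g → State L a B n g → State L a B (n + (suc (f + g) + suc (f + g))) g
extend-even {n = n} f g S = grow T T (λ C → C) [] S (rev (even f g 0 h (5 + n) (h-eq n f g)))
  (inj₂ (jmp n f g)) ↭-refl
  (↭-trans (++-comm _ [ 4 + n ]) (↭-reflexive (cong (rng (4 + n)) (cnt (f + g)))))
  where
  T = suc (f + g)
  h = T + (4 + n)
  h-eq : ∀ n f g → suc (f + g) + (4 + n) ≡ 0 + f + g + (5 + n)
  h-eq = solve-∀
  jmp : ∀ n f g → suc (f + g) + g + (4 + n) ≡ suc (f + g) + (4 + n) + g
  jmp = solve-∀
  cnt : ∀ t → suc (suc (t * 2)) ≡ suc t + suc t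
  cnt = solve-∀

-- Both ends of the new part are low, so the old path must be met from below. After the reflection
-- its end has distance g from the top, and the length `4 + n` leads down from it to the new label
-- f.
extend-odd : ∀ f g → f ≢ g → State L a B n g → State L a B (n + (suc (f + g) + (f + g))) g
extend-odd {n = n} f g f≢g S@(state {VC} _ P v _ _) = grow (suc T) T (λ C → C) [] (mirrorS g′ g+g′ S)
  (rev (odd f g f≢g 0 h (5 + n) (h-eq n f g))) (inj₁ jmp) ↭-refl
  (↭-trans (++-comm _ [ 4 + n ]) (↭-reflexive (cong (rng (4 + n)) (cnt (f + g)))))
  where
  T = f + g
  h = suc T + (4 + n)
  g≤ : g ≤ 3 + n
  g≤ = proj₁ (Walk-ends (proj₁ (proj₂ (proj₂ P))) (All-resp-↭ (↭-sym (proj₁ (proj₂ (proj₂ (proj₂ P))))) (proj₂ (verts-≤ VC v))))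
  g′ = 3 + n ∸ g
  g+g′ : g + g′ ≡ 3 + n
  g+g′ = m+[n∸m]≡n g≤
  h-eq : ∀ n f g → suc (f + g) + (4 + n) ≡ 0 + f + g + (5 + n)
  h-eq = solve-∀
  jmp : f + (4 + n) ≡ suc T + g′
  jmp = trans (cong (λ t → f + suc t) (sym g+g′)) (lem f g g′)
    where
    lem : ∀ f g g′ → f + suc (g + g′) ≡ suc (f + g) + g′
    lem = solve-∀
  cnt : ∀ t → suc (t * 2) ≡ suc t + t
  cnt = solve-∀

data Parity : ℕ → Set where
  evenP : ∀ t → Parity (t + t)
  oddP  : ∀ t → Parity (suc (t + t))

parityView : ∀ n → Parity n
parityView zero = evenP 0
parityView (suc n) with parityView n
... | evenP t = oddP t
... | oddP t  = subst Parity (cong suc (+-suc t t)) (evenP (suc t))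

extend : ∀ g r → r ≢ g + g → State L a B n g → State L a B (n + (suc (g + g) + r)) g
extend {n = n} g r r≢2g S with parityView r
... | evenP f = relabel (cnt n f g) refl (extend-odd f g (λ { refl → r≢2g refl }) S)
  where
  cnt : ∀ n f g → n + (suc (f + g) + (f + g)) ≡ n + (suc (g + g) + (f + f))
  cnt = solve-∀
... | oddP f = relabel (cnt n f g) refl (extend-even f g S)
  where
  cnt : ∀ n f g → n + (suc (f + g) + suc (f + g)) ≡ n + (suc (g + g) + suc (f + f))
  cnt = solve-∀

-- Inserting an odd cycle

-- Nested uses merge consecutive blocks from the right, leaving one linear identity per boundary.
glue : ∀ a m {b n W} → b ≡ a + m → W ≡ rng b n → rng a m ++ W ≡ rng a (m + n)
glue a m {n = n} eq refl = rng-++ m n eq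

last : ∀ b n → rng b n ≡ rng b n
last b n = refl

-- The right-hand side lists the low blocks and then the high blocks in increasing order of their
-- labels.
step-verts : ∀ w vl vh u l₀ h₀ la ha lb hb lc hc ld hd →
  (w ++ (vl ++ vh) ++ u) ++ ((l₀ ++ h₀) ++ ((la ++ ha) ++ ((lb ++ hb) ++ ((lc ++ hc) ++ (ld ++ hd)))))
  ↭ (lb ++ u ++ la ++ lc ++ ld ++ l₀ ++ vl) ++ (vh ++ h₀ ++ hd ++ w ++ hc ++ ha ++ hb)
step-verts = ↭-solve 14 (λ w vl vh u l₀ h₀ la ha lb hb lc hc ld hd →
  (w ⊕ (vl ⊕ vh) ⊕ u) ⊕ ((l₀ ⊕ h₀) ⊕ ((la ⊕ ha) ⊕ ((lb ⊕ hb) ⊕ ((lc ⊕ hc) ⊕ (ld ⊕ hd)))))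
  ⊜ (lb ⊕ u ⊕ la ⊕ lc ⊕ ld ⊕ l₀ ⊕ vl) ⊕ (vh ⊕ h₀ ⊕ hd ⊕ w ⊕ hc ⊕ ha ⊕ hb)) ↭-refl

step-lengths : ∀ κ wv v vu d₀ J₂ da ab db J₃ dc cd dd J₁ →
  (κ ++ (wv ++ v ++ vu)) ++ ((d₀ ++ J₂ ++ (da ++ ab ++ (db ++ J₃ ++ (dc ++ cd ++ dd)))) ++ J₁)
  ↭ J₁ ++ v ++ vu ++ d₀ ++ wv ++ dd ++ cd ++ J₂ ++ dc ++ κ ++ da ++ ab ++ J₃ ++ db
step-lengths = ↭-solve 14 (λ κ wv v vu d₀ J₂ da ab db J₃ dc cd dd J₁ →
  (κ ⊕ (wv ⊕ v ⊕ vu)) ⊕ ((d₀ ⊕ J₂ ⊕ (da ⊕ ab ⊕ (db ⊕ J₃ ⊕ (dc ⊕ cd ⊕ dd)))) ⊕ J₁)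
  ⊜ J₁ ⊕ v ⊕ vu ⊕ d₀ ⊕ wv ⊕ dd ⊕ cd ⊕ J₂ ⊕ dc ⊕ κ ⊕ da ⊕ ab ⊕ J₃ ⊕ db) ↭-refl

-- With g = j + k, the old labels are shifted by s and h is the first label above them. The path
-- enters the block pair (l₀,h₀) at h₀ + k, runs outwards through (la,ha) and (lb,hb), jumps back and
-- runs inwards through (lc,hc) and (ld,hd). The new cycle is w₀, a zigzag between the innermost
-- new labels (lv on the low side, h on the high side), u₀; the edge between lv and u₀ stays on the low side.
-- Here e₀, ea, eb, ec, ed are the innermost lengths of the block pairs, ta, tb, td their sizes minus one,
-- and κ₀ is the length of the edge u₀ w₀, the longest one of the cycle.
module Step (j k : ℕ) where
  n₀ s m h : ℕ
  n₀ = j + 6 * k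
  s  = 5 * j + 8 * k + 8
  m  = 5 * j + 8 * k + 7
  h  = s + (4 + n₀)

  lb la lc ld l₀ lv ha hb hc hd h₀ u₀ w₀ : ℕ
  lb = 0
  u₀ = j + 2 * k + 2
  la = j + 2 * k + 3
  lc = 2 * j + 4 * k + 4
  ld = 3 * j + 6 * k + 5
  l₀ = 4 * j + 7 * k + 6
  lv = 4 * j + 8 * k + 7
  h₀ = h + j
  hd = h + (j + k + 1)
  w₀ = h + (2 * j + 2 * k + 2)
  hc = h + (2 * j + 2 * k + 3)
  ha = h + (3 * j + 4 * k + 4)
  hb = h + (4 * j + 6 * k + 5)

  tb ta td : ℕ
  ta = j + 2 * k
  tb = suc ta
  td = j + k

  e₀ ed ec ea eb κ₀ : ℕ
  e₀ = 3 * j + 6 * k + 6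
  ed = 3 * j + 8 * k + 8
  ec = 5 * j + 10 * k + 11
  κ₀ = 7 * j + 14 * k + 12
  ea = 7 * j + 14 * k + 13
  eb = 9 * j + 18 * k + 16

  cycleV cycleD : List ℕ
  cycleV = w₀ ∷ (rng lv (suc j) ++ rng h j) ++ [ u₀ ]
  cycleD = 3 * j + 8 * k + 7 ∷ rng (5 + n₀) (j * 2) ++ [ 3 * j + 6 * k + 5 ]

  routeV routeD : List ℕ
  routeV = (rng l₀ (suc k) ++ rng h₀ (suc k)) ++ ((rng la (suc ta) ++ rng ha (suc ta)) ++ ((rng lb (suc tb) ++ rng hb (suc tb)) ++
           ((rng lc (suc ta) ++ rng hc (suc ta)) ++ (rng ld (suc td) ++ rng hd (suc td)))))
  routeD = rng e₀ (suc (k * 2)) ++ [ 5 * j + 10 * k + 10 ] ++ (rng ea (suc (ta * 2)) ++ [ 9 * j + 18 * k + 14 ] ++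
           (rng eb (suc (tb * 2)) ++ [ 9 * j + 18 * k + 15 ] ++ (rng ec (suc (ta * 2)) ++ [ 5 * j + 10 * k + 9 ] ++ rng ed (suc (td * 2)))))

  route : Path (h₀ + k) (ld + td) routeV routeD
  route =
    join (zigH k l₀ h₀ e₀ (q₁ j k))
      (inj₁ (q₂ j k) ) (join (rev (zigL ta la ha ea (q₃ j k)))
      (inj₁ (q₄ j k)) (join (rev (zigL tb lb hb eb (q₅ j k)))
      (inj₁ (q₆ j k)) (join (zigH ta lc hc ec (q₇ j k))
      (inj₁ (q₈ j k)) (zigH td ld hd ed (q₉ j k)))))
    where
    q₁ : ∀ j k → 5 * j + 8 * k + 8 + (4 + (j + 6 * k)) + j ≡ 4 * j + 7 * k + 6 + k + (3 * j + 6 * k + 6)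
    q₁ = solve-∀
    q₂ : ∀ j k → 4 * j + 7 * k + 6 + k + (5 * j + 10 * k + 10) ≡ 5 * j + 8 * k + 8 + (4 + (j + 6 * k)) + (3 * j + 4 * k + 4)
    q₂ = solve-∀
    q₃ : ∀ j k → 5 * j + 8 * k + 8 + (4 + (j + 6 * k)) + (3 * j + 4 * k + 4) ≡ j + 2 * k + 3 + (j + 2 * k) + (7 * j + 14 * k + 13)
    q₃ = solve-∀
    q₄ : ∀ j k → j + 2 * k + 3 + (9 * j + 18 * k + 14) ≡ 5 * j + 8 * k + 8 + (4 + (j + 6 * k)) + (4 * j + 6 * k + 5)
    q₄ = solve-∀
    q₅ : ∀ j k → 5 * j + 8 * k + 8 + (4 + (j + 6 * k)) + (4 * j + 6 * k + 5) ≡ suc (j + 2 * k) + (9 * j + 18 * k + 16)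
    q₅ = solve-∀
    q₆ : ∀ j k → 9 * j + 18 * k + 15 ≡ 5 * j + 8 * k + 8 + (4 + (j + 6 * k)) + (2 * j + 2 * k + 3) + (j + 2 * k)
    q₆ = solve-∀
    q₇ : ∀ j k → 5 * j + 8 * k + 8 + (4 + (j + 6 * k)) + (2 * j + 2 * k + 3) ≡ 2 * j + 4 * k + 4 + (j + 2 * k) + (5 * j + 10 * k + 11)
    q₇ = solve-∀
    q₈ : ∀ j k → 2 * j + 4 * k + 4 + (j + 2 * k) + (5 * j + 10 * k + 9) ≡ 5 * j + 8 * k + 8 + (4 + (j + 6 * k)) + (j + k + 1) + (j + k)
    q₈ = solve-∀
    q₉ : ∀ j k → 5 * j + 8 * k + 8 + (4 + (j + 6 * k)) + (j + k + 1) ≡ 3 * j + 6 * k + 5 + (j + k) + (3 * j + 8 * k + 8)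
    q₉ = solve-∀

  cycle : Path w₀ u₀ cycleV cycleD
  cycle = inj₂ (q₁ j k) ◂ join (rev (zigLL j lv h (5 + n₀) (q₂ j k))) (inj₂ (q₃ j k)) (point u₀)
    where
    q₁ : ∀ j k → 4 * j + 8 * k + 7 + j + (3 * j + 8 * k + 7) ≡ 5 * j + 8 * k + 8 + (4 + (j + 6 * k)) + (2 * j + 2 * k + 2)
    q₁ = solve-∀
    q₂ : ∀ j k → 5 * j + 8 * k + 8 + (4 + (j + 6 * k)) ≡ 4 * j + 8 * k + 7 + j + (5 + (j + 6 * k))
    q₂ = solve-∀
    q₃ : ∀ j k → j + 2 * k + 2 + (3 * j + 6 * k + 5) ≡ 4 * j + 8 * k + 7
    q₃ = solve-∀

  closing : Dist u₀ w₀ κ₀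
  closing = inj₁ (lem j k)
    where
    lem : ∀ j k → j + 2 * k + 2 + (7 * j + 14 * k + 12) ≡ 5 * j + 8 * k + 8 + (4 + (j + 6 * k)) + (2 * j + 2 * k + 2)
    lem = solve-∀

  lows : rng lb (suc tb) ++ [ u₀ ] ++ rng la (suc ta) ++ rng lc (suc ta) ++ rng ld (suc td) ++ rng l₀ (suc k) ++ rng lv (suc j)
         ≡ rng 0 s
  lows = trans
    (glue lb (suc tb) (q₁ j k) (glue u₀ 1 (q₂ j k) (glue la (suc ta) (q₃ j k) (glue lc (suc ta) (q₄ j k)
    (glue ld (suc td) (q₅ j k) (glue l₀ (suc k) (q₆ j k) (last lv (suc j))))))))
    (cong (rng 0) (q₇ j k))
    where
    q₁ : ∀ j k → j + 2 * k + 2 ≡ suc (suc (j + 2 * k))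
    q₁ = solve-∀
    q₂ : ∀ j k → j + 2 * k + 3 ≡ j + 2 * k + 2 + 1
    q₂ = solve-∀
    q₃ : ∀ j k → 2 * j + 4 * k + 4 ≡ j + 2 * k + 3 + suc (j + 2 * k)
    q₃ = solve-∀
    q₄ : ∀ j k → 3 * j + 6 * k + 5 ≡ 2 * j + 4 * k + 4 + suc (j + 2 * k)
    q₄ = solve-∀
    q₅ : ∀ j k → 4 * j + 7 * k + 6 ≡ 3 * j + 6 * k + 5 + suc (j + k)
    q₅ = solve-∀
    q₆ : ∀ j k → 4 * j + 8 * k + 7 ≡ 4 * j + 7 * k + 6 + suc k
    q₆ = solve-∀
    q₇ : ∀ j k → suc (suc (j + 2 * k)) + (1 + (suc (j + 2 * k) + (suc (j + 2 * k) + (suc (j + k) + (suc k + suc j))))) ≡ 5 * j + 8 * k + 8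
    q₇ = solve-∀

  highs : rng h j ++ rng h₀ (suc k) ++ rng hd (suc td) ++ [ w₀ ] ++ rng hc (suc ta) ++ rng ha (suc ta) ++ rng hb (suc tb)
          ≡ rng h m
  highs = trans
    (glue h j refl (glue h₀ (suc k) (q₁ h j k) (glue hd (suc td) (q₂ h j k) (glue w₀ 1 (q₃ h j k)
    (glue hc (suc ta) (q₄ h j k) (glue ha (suc ta) (q₅ h j k) (last hb (suc tb))))))))
    (cong (rng h) (q₆ j k))
    where
    q₁ : ∀ h j k → h + (j + k + 1) ≡ h + j + suc k
    q₁ = solve-∀
    q₂ : ∀ h j k → h + (2 * j + 2 * k + 2) ≡ h + (j + k + 1) + suc (j + k)
    q₂ = solve-∀
    q₃ : ∀ h j k → h + (2 * j + 2 * k + 3) ≡ h + (2 * j + 2 * k + 2) + 1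
    q₃ = solve-∀
    q₄ : ∀ h j k → h + (3 * j + 4 * k + 4) ≡ h + (2 * j + 2 * k + 3) + suc (j + 2 * k)
    q₄ = solve-∀
    q₅ : ∀ h j k → h + (4 * j + 6 * k + 5) ≡ h + (3 * j + 4 * k + 4) + suc (j + 2 * k)
    q₅ = solve-∀
    q₆ : ∀ j k → j + (suc k + (suc (j + k) + (1 + (suc (j + 2 * k) + (suc (j + 2 * k) + suc (suc (j + 2 * k))))))) ≡ 5 * j + 8 * k + 7
    q₆ = solve-∀

  -- In increasing order, single lengths alternate with zigzags. `4 + n₀` leads to the old path,
  -- `3 * j + 6 * k + 5` is the edge of the cycle inside the low side, `3 * j + 8 * k + 7` and `κ₀`
  -- are the two edges at `w₀`, and the pairs near 5j+10k and 9j+18k are the jumps of `route`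
  -- between block pairs.
  lengths :
    [ 4 + n₀ ] ++ rng (5 + n₀) (j * 2) ++ [ 3 * j + 6 * k + 5 ] ++ rng e₀ (suc (k * 2)) ++ [ 3 * j + 8 * k + 7 ] ++
    rng ed (suc (td * 2)) ++ [ 5 * j + 10 * k + 9 ] ++ [ 5 * j + 10 * k + 10 ] ++ rng ec (suc (ta * 2)) ++ [ κ₀ ] ++
    rng ea (suc (ta * 2)) ++ [ 9 * j + 18 * k + 14 ] ++ [ 9 * j + 18 * k + 15 ] ++ rng eb (suc (tb * 2))
    ≡ rng (4 + n₀) (s + m)
  lengths = trans
    (glue (4 + n₀) 1 (q₁ j k) (glue (5 + n₀) (j * 2) (q₂ j k) (glue (3 * j + 6 * k + 5) 1 (q₃ j k)
    (glue e₀ (suc (k * 2)) (q₄ j k) (glue (3 * j + 8 * k + 7) 1 (q₅ j k) (glue ed (suc (td * 2)) (q₆ j k)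
    (glue (5 * j + 10 * k + 9) 1 (q₇ j k) (glue (5 * j + 10 * k + 10) 1 (q₈ j k) (glue ec (suc (ta * 2)) (q₉ j k)
    (glue κ₀ 1 (q₁₀ j k) (glue ea (suc (ta * 2)) (q₁₁ j k) (glue (9 * j + 18 * k + 14) 1 (q₁₂ j k)
    (glue (9 * j + 18 * k + 15) 1 (q₁₃ j k) (last eb (suc (tb * 2))))))))))))))))
    (cong (rng (4 + n₀)) (q₁₄ j k))
    where
    q₁ : ∀ j k → 5 + (j + 6 * k) ≡ 4 + (j + 6 * k) + 1
    q₁ = solve-∀
    q₂ : ∀ j k → 3 * j + 6 * k + 5 ≡ 5 + (j + 6 * k) + j * 2
    q₂ = solve-∀
    q₃ : ∀ j k → 3 * j + 6 * k + 6 ≡ 3 * j + 6 * k + 5 + 1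
    q₃ = solve-∀
    q₄ : ∀ j k → 3 * j + 8 * k + 7 ≡ 3 * j + 6 * k + 6 + suc (k * 2)
    q₄ = solve-∀
    q₅ : ∀ j k → 3 * j + 8 * k + 8 ≡ 3 * j + 8 * k + 7 + 1
    q₅ = solve-∀
    q₆ : ∀ j k → 5 * j + 10 * k + 9 ≡ 3 * j + 8 * k + 8 + suc ((j + k) * 2)
    q₆ = solve-∀
    q₇ : ∀ j k → 5 * j + 10 * k + 10 ≡ 5 * j + 10 * k + 9 + 1
    q₇ = solve-∀
    q₈ : ∀ j k → 5 * j + 10 * k + 11 ≡ 5 * j + 10 * k + 10 + 1
    q₈ = solve-∀
    q₉ : ∀ j k → 7 * j + 14 * k + 12 ≡ 5 * j + 10 * k + 11 + suc ((j + 2 * k) * 2)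
    q₉ = solve-∀
    q₁₀ : ∀ j k → 7 * j + 14 * k + 13 ≡ 7 * j + 14 * k + 12 + 1
    q₁₀ = solve-∀
    q₁₁ : ∀ j k → 9 * j + 18 * k + 14 ≡ 7 * j + 14 * k + 13 + suc ((j + 2 * k) * 2)
    q₁₁ = solve-∀
    q₁₂ : ∀ j k → 9 * j + 18 * k + 15 ≡ 9 * j + 18 * k + 14 + 1
    q₁₂ = solve-∀
    q₁₃ : ∀ j k → 9 * j + 18 * k + 16 ≡ 9 * j + 18 * k + 15 + 1
    q₁₃ = solve-∀
    q₁₄ : ∀ j k → 1 + (j * 2 + (1 + (suc (k * 2) + (1 + (suc ((j + k) * 2) + (1 + (1 + (suc ((j + 2 * k) * 2) + (1 +
            (suc ((j + 2 * k) * 2) + (1 + (1 + suc (suc (j + 2 * k) * 2)))))))))))))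
          ≡ 5 * j + 8 * k + 8 + (5 * j + 8 * k + 7)
    q₁₄ = solve-∀

  all-verts : cycleV ++ routeV ↭ rng 0 s ++ rng h m
  all-verts = ↭-trans
    (step-verts [ w₀ ] (rng lv (suc j)) (rng h j) [ u₀ ] (rng l₀ (suc k)) (rng h₀ (suc k)) (rng la (suc ta)) (rng ha (suc ta))
       (rng lb (suc tb)) (rng hb (suc tb)) (rng lc (suc ta)) (rng hc (suc ta)) (rng ld (suc td)) (rng hd (suc td)))
    (↭-reflexive (cong₂ _++_ lows highs))

  all-lengths : (κ₀ ∷ cycleD) ++ routeD ++ [ 4 + n₀ ] ↭ rng (4 + n₀) (s + m)
  all-lengths = ↭-trans
    (step-lengths [ κ₀ ] [ 3 * j + 8 * k + 7 ] (rng (5 + n₀) (j * 2)) [ 3 * j + 6 * k + 5 ] (rng e₀ (suc (k * 2)))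
       [ 5 * j + 10 * k + 10 ] (rng ea (suc (ta * 2))) [ 9 * j + 18 * k + 14 ] (rng eb (suc (tb * 2)))
       [ 9 * j + 18 * k + 15 ] (rng ec (suc (ta * 2))) [ 5 * j + 10 * k + 9 ] (rng ed (suc (td * 2))) [ 4 + n₀ ])
    (↭-reflexive lengths)

  cycle-length : length cycleV ≡ 3 + j * 2
  cycle-length = cong suc (trans (length-++ (rng lv (suc j) ++ rng h j))
    (trans (cong (_+ 1) (trans (length-++ (rng lv (suc j))) (cong₂ _+_ (length-rng lv (suc j)) (length-rng h j)))) (cnt j)))
    where
    cnt : ∀ j → suc j + j + 1 ≡ 2 + j * 2
    cnt = solve-∀

  small : κ₀ ≤ B → All (_≤ B) cycleD
  small {B} κ≤B = below (b₁ j k) ∷ ++⁺ (rng-≤ _ _ (≤-trans (below (b₂ j k)) (n≤1+n B))) (below (b₃ j k) ∷ [])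
    where
    below : ∀ {x y} → x + y ≡ κ₀ → x ≤ B
    below {x} {y} eq = ≤-trans (m≤m+n x y) (≤-trans (≤-reflexive eq) κ≤B)
    b₁ : ∀ j k → 3 * j + 8 * k + 7 + (4 * j + 6 * k + 5) ≡ 7 * j + 14 * k + 12
    b₁ = solve-∀
    b₂ : ∀ j k → 5 + (j + 6 * k) + j * 2 + (4 * j + 8 * k + 7) ≡ 7 * j + 14 * k + 12
    b₂ = solve-∀
    b₃ : ∀ j k → 3 * j + 6 * k + 5 + (4 * j + 8 * k + 7) ≡ 7 * j + 14 * k + 12
    b₃ = solve-∀

  step : κ₀ ≤ B → State L a B n₀ (j + k) → State (3 + j * 2 ∷ L) a B (11 * j + 22 * k + 15) (4 * j + 7 * k + 5)
  step {B} {L} {a} κ≤B S = relabel (q₁ j k) (q₂ j k) (add cycle)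
    where
    q₁ : ∀ j k → j + 6 * k + (5 * j + 8 * k + 8 + (5 * j + 8 * k + 7)) ≡ 11 * j + 22 * k + 15
    q₁ = solve-∀
    q₂ : ∀ j k → 3 * j + 6 * k + 5 + (j + k) ≡ 4 * j + 7 * k + 5
    q₂ = solve-∀
    q₃ : ∀ j k → 5 * j + 8 * k + 8 + (j + k) + (4 + (j + 6 * k)) ≡ 5 * j + 8 * k + 8 + (4 + (j + 6 * k)) + j + k
    q₃ = solve-∀
    add : Path w₀ u₀ cycleV cycleD → State (3 + j * 2 ∷ L) a B (n₀ + (s + m)) (ld + td)
    add (X , Y , walk , vX , eY) =
      grow s m (cyc walk closing (trans (↭-length vX) cycle-length)) (κ≤B ∷ All-resp-↭ (↭-sym eY) (small κ≤B))
        S (rev route) (inj₂ (q₃ j k))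
        (↭-trans (++⁺ʳ routeV vX) all-verts)
        (↭-trans (prep κ₀ (++⁺ʳ (routeD ++ [ 4 + n₀ ]) eY)) all-lengths)

-- Labelings with one cycle

-- A graceful labeling of the path with g edges that has an end at i. It comes from `even` and `odd`
-- with e = 1, where the two blocks touch.
Hole : ℕ → ℕ → Set
Hole g i = ∃ λ q → Path i q (rng 0 (suc g)) (rng 1 g)

hole-mirror : ∀ {g i} i′ → i + i′ ≡ g → Hole g i → Hole g i′
hole-mirror {i = i} i′ refl (q , P) = _ , ends (m+n∸m≡n i i′) refl
  (reperm (mirror-rng 0 (suc (i + i′)) 0 (+-identityʳ _)) ↭-refl (mirror (i + i′) (rng-≤ 0 _ ≤-refl) P))

hole-even : ∀ f d → Hole (suc ((f + d) + (f + d))) d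
hole-even f d = _ , reperm
  (↭-reflexive (trans (rng-++ (suc (f + d)) (suc (f + d)) refl) (cong (rng 0) (cnt₁ (f + d)))))
  (↭-reflexive (cong (rng 1) (cnt₂ (f + d))))
  (rev (even f d 0 (suc (f + d)) 1 (+-comm 1 (f + d))))
  where
  cnt₁ : ∀ t → suc t + suc t ≡ suc (suc (t + t))
  cnt₁ = solve-∀
  cnt₂ : ∀ t → suc (t * 2) ≡ suc (t + t)
  cnt₂ = solve-∀

hole-odd : ∀ f d → f ≢ d → Hole ((f + d) + (f + d)) f
hole-odd f d f≢d = _ , reperm
  (↭-reflexive (rng-++ (suc (f + d)) (f + d) refl))
  (↭-reflexive (cong (rng 1) (cnt (f + d))))
  (odd f d f≢d 0 (suc (f + d)) 1 (+-comm 1 (f + d)))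
  where
  cnt : ∀ t → t * 2 ≡ t + t
  cnt = solve-∀

-- The zigzag of the cycle uses the lengths from 2+g on and its closing edge the length 1+g. Between
-- its blocks it leaves just g+1 labels, and the lengths 1,...,g remain: room for a graceful path.
wrap : ∀ {g i} → Hole g i → State [ 3 + g * 2 ] 0 (3 + g * 3) (g * 3) (2 + g + i)
wrap {g} {i} (_ , P) with zigLL (suc g) 0 (3 + g * 2) (2 + g) (eq g)
  where
  eq : ∀ g → 3 + g * 2 ≡ suc g + (2 + g)
  eq = solve-∀
... | X , Y , walk , vX , eY = state (cyc walk (inj₂ refl) len none) (shiftP (2 + g) P)
  (↭-trans (++-cong (↭-trans (↭-reflexive (++-identityʳ X)) vX) (↭-reflexive (shift-rng (2 + g) 0 (suc g))))
    (↭-trans (↭-solve 3 (λ a b c → (a ⊕ b) ⊕ c ⊜ a ⊕ c ⊕ b) ↭-refl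
                (rng 0 (2 + g)) (rng (3 + g * 2) (suc g)) (rng (2 + g + 0) (suc g)))
    (↭-reflexive (trans (glue 0 (2 + g) (+-identityʳ _) (glue (2 + g + 0) (suc g) (q₁ g) (last (3 + g * 2) (suc g))))
      (cong (rng 0) (q₂ g))))))
  (↭-trans (++⁺ʳ (rng 1 g) (prep (suc g) (↭-trans (↭-reflexive (++-identityʳ Y)) eY)))
    (↭-trans (↭-solve 3 (λ a b c → (a ⊕ b) ⊕ c ⊜ c ⊕ a ⊕ b) ↭-refl [ suc g ] (rng (2 + g) (suc g * 2)) (rng 1 g))
    (↭-reflexive (trans (glue 1 g refl (glue (suc g) 1 (q₃ g) (last (2 + g) (suc g * 2)))) (cong (rng 1) (q₄ g))))))
  (≤-trans (m≤m+n (suc g) _) (≤-reflexive (q₅ g))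
    ∷ subst (All _) (sym (++-identityʳ Y)) (All-resp-↭ (↭-sym eY) (rng-≤ (2 + g) (suc g * 2) (≤-reflexive (q₆ g)))))
  where
  q₁ : ∀ g → 3 + g * 2 ≡ 2 + g + 0 + suc g
  q₁ = solve-∀
  q₂ : ∀ g → 2 + g + (suc g + suc g) ≡ 4 + g * 3
  q₂ = solve-∀
  q₃ : ∀ g → 2 + g ≡ suc g + 1
  q₃ = solve-∀
  q₄ : ∀ g → g + (1 + suc g * 2) ≡ 3 + g * 3
  q₄ = solve-∀
  q₅ : ∀ g → suc g + (2 + g * 2) ≡ 3 + g * 3
  q₅ = solve-∀
  q₆ : ∀ g → 2 + g + suc g * 2 ≡ suc (3 + g * 3)
  q₆ = solve-∀
  len : length X ≡ 3 + g * 2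
  len = trans (↭-length vX) (trans (length-++ (rng 0 (2 + g)))
    (trans (cong₂ _+_ (length-rng 0 (2 + g)) (length-rng (3 + g * 2) (suc g))) (cnt g)))
    where
    cnt : ∀ g → 2 + g + suc g ≡ 3 + g * 2
    cnt = solve-∀

wrap-mirror : ∀ {g i} i′ → i + i′ + 1 ≡ g → Hole g i → State [ 3 + g * 2 ] 0 (3 + g * 3) (g * 3) (2 + g + i′)
wrap-mirror {i = i} i′ refl H = mirrorS _ (eq i i′) (wrap H)
  where
  eq : ∀ i i′ → 2 + (i + i′ + 1) + i + (2 + (i + i′ + 1) + i′) ≡ 3 + (i + i′ + 1) * 3
  eq = solve-∀

-- hole-odd excludes i = c in near and i′ = c in far; then a path ending at a neighbouring position
-- is used and the labeling is mirrored, which works because the two sides of the cycle differ by one.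
one-cycle : ∀ g i → i ≤ g → State [ 3 + g * 2 ] 0 (3 + g * 3) (g * 3) (2 + g + i)
one-cycle g i i≤g with parityView g
... | oddP t with i ≤? t
... | yes i≤t = wrap (subst (λ t → Hole (suc (t + t)) i) (m∸n+n≡m i≤t) (hole-even (t ∸ i) i))
... | no i≰t = wrap (hole-mirror i (m∸n+n≡m i≤g) (subst (λ t → Hole (suc (t + t)) i′) (m∸n+n≡m i′≤t) (hole-even (t ∸ i′) i′)))
  where
  i′ = suc (t + t) ∸ i
  i′≤t : i′ ≤ t
  i′≤t = ≤-trans (∸-monoʳ-≤ (suc (t + t)) (≰⇒> i≰t)) (≤-reflexive (m+n∸m≡n t t))
one-cycle g i i≤g | evenP t with i ≤? t
... | yes i≤t = near (t ∸ i) (m+[n∸m]≡n i≤t)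
  where
  near : ∀ c → i + c ≡ t → State [ 3 + (t + t) * 2 ] 0 (3 + (t + t) * 3) ((t + t) * 3) (2 + (t + t) + i)
  near c refl with i ≟ c
  ... | no i≢c = wrap (hole-odd i c i≢c)
  near zero refl | yes refl = wrap (0 , point 0)
  near (suc c) refl | yes refl = wrap-mirror (suc c) (eq₁ c)
    (hole-mirror (2 * c + 2 + c) (eq₂ c) (subst (λ t → Hole (t + t) (2 + c)) (eq₃ c) (hole-odd (2 + c) c (λ ()))))
    where
    eq₁ : ∀ c → 2 * c + 2 + c + suc c + 1 ≡ suc c + suc c + (suc c + suc c)
    eq₁ = solve-∀
    eq₂ : ∀ c → 2 + c + (2 * c + 2 + c) ≡ suc c + suc c + (suc c + suc c)
    eq₂ = solve-∀
    eq₃ : ∀ c → 2 + c + c ≡ suc c + suc c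
    eq₃ = solve-∀
... | no i≰t = far (t + t ∸ i) (m∸n+n≡m i≤g)
  where
  far : ∀ i′ → i′ + i ≡ t + t → State [ 3 + (t + t) * 2 ] 0 (3 + (t + t) * 3) ((t + t) * 3) (2 + (t + t) + i)
  far i′ eq = go (t ∸ i′) (m+[n∸m]≡n i′≤t)
    where
    i′≤t : i′ ≤ t
    i′≤t = +-cancelʳ-≤ t i′ t (≤-trans (+-monoʳ-≤ i′ (<⇒≤ (≰⇒> i≰t))) (≤-reflexive eq))
    go : ∀ c → i′ + c ≡ t → State [ 3 + (t + t) * 2 ] 0 (3 + (t + t) * 3) ((t + t) * 3) (2 + (t + t) + i)
    go c e with i′ ≟ c
    ... | no i′≢c = wrap (hole-mirror i eq (subst (λ t → Hole (t + t) i′) e (hole-odd i′ c i′≢c)))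
    go zero e | yes refl = contradiction (≤-trans (≤-reflexive (trans eq (cong (λ t → t + t) (sym e)))) z≤n) i≰t
    go (suc c) e | yes refl = wrap-mirror i (trans (lem c i) eq)
      (subst (λ t → Hole (t + t) c) (trans (eq₃ c) e) (hole-odd c (2 + c) (λ ())))
      where
      lem : ∀ c i → c + i + 1 ≡ suc c + i
      lem = solve-∀
      eq₃ : ∀ c → c + (2 + c) ≡ suc c + suc c
      eq₃ = solve-∀

-- The recursion

advance : ∀ j k r → n + r + j + 1 ≡ 4 * k → r ≢ j + k + (j + k) → 7 * j + 14 * k + 12 ≤ B →
          State L a B n (j + k) → State (3 + j * 2 ∷ L) a B (11 * j + 22 * k + 15) (4 * j + 7 * k + 5)
advance {n = n} j k r eq r≢ κ≤B S = Step.step j k κ≤B (relabel size refl (extend (j + k) r r≢ S))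
  where
  -- The hypothesis on `r` says that the extension ends at the tuned size `n₀` of `Step`.
  size : n + (suc (j + k + (j + k)) + r) ≡ j + 6 * k
  size = trans (lem₁ n j k r) (trans (cong (λ t → t + (j + 2 * k)) eq) (lem₂ j k))
    where
    lem₁ : ∀ n j k r → n + (suc (j + k + (j + k)) + r) ≡ n + r + j + 1 + (j + 2 * k)
    lem₁ = solve-∀
    lem₂ : ∀ j k → 4 * k + (j + 2 * k) ≡ j + 6 * k
    lem₂ = solve-∀

by : ∀ {x y} z → x + z ≡ y → x ≤ y
by {x} z eq = ≤-trans (m≤m+n x z) (≤-reflexive eq)

-- X is the value of ε₁ for L. The inequality final-≤ makes extend reach every ε ≥ 3X, and next-≤
-- implies final-≤ and the bound on cycle lengths after the next step; M bounds the remaining cycles.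
record Stage (M X : ℕ) (L : List ℕ) (a : ℕ) : Set where
  constructor stage
  field
    j k     : ℕ
    label   : State L a X (11 * j + 22 * k + 15) (4 * j + 7 * k + 5)
    room    : M ≤ j + k
    final-≤ : 27 * j + 50 * k + 40 ≤ 3 * X
    next-≤  : 150 * (4 * j + 7 * k + 5) + 125 ≤ 63 * X

-- With g = j + k and j = 0, three times the conclusion reads 150g + 120 ≤ 63X. Raising 120 to 125
-- makes the left side 150(g + 5/6), and g + 5/6 grows at most sevenfold when g becomes 7g + 5 - 3j.
-- This is the origin of the invariant `next-≤`.
next-final : ∀ j k X → 150 * (j + k) + 125 ≤ 63 * X → 27 * j + 50 * k + 40 ≤ 3 * (7 * X)
next-final j k X h = *-cancelˡ-≤ {27 * j + 50 * k + 40} {3 * (7 * X)} 3 (begin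
  3 * (27 * j + 50 * k + 40) ≤⟨ by {3 * (27 * j + 50 * k + 40)} (69 * j + 5) (lem₁ j k) ⟩
  150 * (j + k) + 125        ≤⟨ h ⟩
  63 * X                     ≡⟨ lem₂ X ⟩
  3 * (3 * (7 * X))          ∎)
  where
  open ≤-Reasoning
  lem₁ : ∀ j k → 3 * (27 * j + 50 * k + 40) + (69 * j + 5) ≡ 150 * (j + k) + 125
  lem₁ = solve-∀
  lem₂ : ∀ X → 63 * X ≡ 3 * (3 * (7 * X))
  lem₂ = solve-∀

next-length : ∀ j k X → 150 * (j + k) + 125 ≤ 63 * X → 7 * j + 14 * k + 12 ≤ 7 * X
next-length j k X h = *-cancelˡ-≤ {7 * j + 14 * k + 12} {7 * X} 9 (begin
  9 * (7 * j + 14 * k + 12) ≤⟨ by {9 * (7 * j + 14 * k + 12)} (87 * j + 24 * k + 17) (lem₁ j k) ⟩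
  150 * (j + k) + 125       ≤⟨ h ⟩
  63 * X                    ≡⟨ lem₂ X ⟩
  9 * (7 * X)               ∎)
  where
  open ≤-Reasoning
  lem₁ : ∀ j k → 9 * (7 * j + 14 * k + 12) + (87 * j + 24 * k + 17) ≡ 150 * (j + k) + 125
  lem₁ = solve-∀
  lem₂ : ∀ X → 63 * X ≡ 9 * (7 * X)
  lem₂ = solve-∀

next-next : ∀ j k X → 150 * (j + k) + 125 ≤ 63 * X → 150 * (4 * j + 7 * k + 5) + 125 ≤ 63 * (7 * X)
next-next j k X h = begin
  150 * (4 * j + 7 * k + 5) + 125 ≤⟨ by {150 * (4 * j + 7 * k + 5) + 125} (450 * j) (lem₁ j k) ⟩
  7 * (150 * (j + k) + 125)       ≤⟨ *-monoʳ-≤ 7 {150 * (j + k) + 125} {63 * X} h ⟩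
  7 * (63 * X)                    ≡⟨ lem₂ X ⟩
  63 * (7 * X)                    ∎
  where
  open ≤-Reasoning
  lem₁ : ∀ j k → 150 * (4 * j + 7 * k + 5) + 125 + 450 * j ≡ 7 * (150 * (j + k) + 125)
  lem₁ = solve-∀
  lem₂ : ∀ X → 7 * (63 * X) ≡ 63 * (7 * X)
  lem₂ = solve-∀

next : ∀ {j′} → j′ ≤ M → Stage M X L a → Stage M (7 * X) (3 + j′ * 2 ∷ L) a
next {M} {X} {j′ = j′} j′≤M (stage j k S room _ inv) = stage j′ k′
  -- The present end `4 * j + 7 * k + 5` must equal `j′ + k′`, which determines `k′`; the size
  -- equation of `advance` then determines the number `5 * c + k + 4`. It is natural because `room`
  -- gives j′ ≤ j + k, and it stays below the exceptional value by `r<`.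
  (advance j′ k′ (5 * c + k + 4) eq-r (<⇒≢ r<) (next-length j′ k′ X inv′) (widen (m≤m+n X _) (relabel refl G≡ S)))
  (≤-trans room (≤-trans (by (3 * j + 6 * k + 5) (b₁ j k)) (≤-reflexive G≡)))
  (next-final j′ k′ X inv′) (next-next j′ k′ X inv′)
  where
  c = j + k ∸ j′
  j′+c : j′ + c ≡ j + k
  j′+c = m+[n∸m]≡n (≤-trans j′≤M room)
  k′ = c + (3 * j + 6 * k + 5)
  G≡ : 4 * j + 7 * k + 5 ≡ j′ + k′
  G≡ = trans (g₁ j k) (trans (cong (_+ (3 * j + 6 * k + 5)) (sym j′+c)) (+-assoc j′ c _))
    where
    g₁ : ∀ j k → 4 * j + 7 * k + 5 ≡ j + k + (3 * j + 6 * k + 5)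
    g₁ = solve-∀
  eq-r : 11 * j + 22 * k + 15 + (5 * c + k + 4) + j′ + 1 ≡ 4 * k′
  eq-r = trans (e₁ j k c j′) (trans (cong (_+ (11 * j + 23 * k + 4 * c + 20)) j′+c) (e₂ j k c))
    where
    e₁ : ∀ j k c j′ → 11 * j + 22 * k + 15 + (5 * c + k + 4) + j′ + 1 ≡ j′ + c + (11 * j + 23 * k + 4 * c + 20)
    e₁ = solve-∀
    e₂ : ∀ j k c → j + k + (11 * j + 23 * k + 4 * c + 20) ≡ 4 * (c + (3 * j + 6 * k + 5))
    e₂ = solve-∀
  r< : 5 * c + k + 4 < j′ + k′ + (j′ + k′)
  r< = by (5 * j′ + 3 * j + 8 * k + 5) (trans (e₁ j k c j′)
    (trans (cong (λ t → 5 * t + (3 * j + 9 * k + 10)) j′+c) (trans (e₂ j k) (cong₂ _+_ G≡ G≡))))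
    where
    e₁ : ∀ j k c j′ → suc (5 * c + k + 4) + (5 * j′ + 3 * j + 8 * k + 5) ≡ 5 * (j′ + c) + (3 * j + 9 * k + 10)
    e₁ = solve-∀
    e₂ : ∀ j k → 5 * (j + k) + (3 * j + 9 * k + 10) ≡ 4 * j + 7 * k + 5 + (4 * j + 7 * k + 5)
    e₂ = solve-∀
  b₁ : ∀ j k → j + k + (3 * j + 6 * k + 5) ≡ 4 * j + 7 * k + 5
  b₁ = solve-∀
  inv′ : 150 * (j′ + k′) + 125 ≤ 63 * X
  inv′ = subst (λ g → 150 * g + 125 ≤ 63 * X) G≡ inv

cyc-len : ℕ → ℕ
cyc-len j = 3 + j * 2

7*-assoc : ∀ t X → t * (7 * X) ≡ 7 * t * X
7*-assoc = solve-∀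

chain : ∀ js → All (_≤ M) js → Stage M X L a →
        ∃ λ L′ → L′ ↭ map cyc-len js ++ L × Stage M (7 ^ length js * X) L′ a
chain {M} {X} {L} {a} [] _ S = L , ↭-refl , subst (λ X → Stage M X L a) (sym (*-identityˡ X)) S
chain {M} {X} {L} {a} (j ∷ js) (j≤M ∷ js≤M) S =
  proj₁ rest , ↭-trans (proj₁ (proj₂ rest)) (shift (cyc-len j) (map cyc-len js) L) ,
  subst (λ X → Stage M X (proj₁ rest) a) (7*-assoc (7 ^ length js) X) (proj₂ (proj₂ rest))
  where
  rest : ∃ λ L′ → L′ ↭ map cyc-len js ++ cyc-len j ∷ L × Stage M (7 ^ length js * (7 * X)) L′ a
  rest = chain js js≤M (next j≤M S)

Labels : List ℕ → ℕ → ℕ → ℕ → Set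
Labels L a X ε = ∃₂ λ n p → ε ≡ 3 + n × State L a X n p

-- Beyond the exception, that is from 4G + 2 new labels on, `extend` has no gaps. The size 3 + (11j
-- + 22k + 15) plus 4G + 2 is the left side of `final-≤`.
finish : ∀ ε → 3 * X ≤ ε → Stage M X L a → Labels L a X ε
finish {X = X} ε le (stage j k S _ final _) =
  _ , _ , trans (sym ε≡) (eq j k r) , extend G (suc (G + G + r)) (λ e → m≢1+m+n (G + G) (sym e)) S
  where
  G = 4 * j + 7 * k + 5
  r = ε ∸ (27 * j + 50 * k + 40)
  ε≡ : 27 * j + 50 * k + 40 + r ≡ ε
  ε≡ = m+[n∸m]≡n (≤-trans final le)
  eq : ∀ j k r → 27 * j + 50 * k + 40 + r ≡
    3 + (11 * j + 22 * k + 15 + (suc (4 * j + 7 * k + 5 + (4 * j + 7 * k + 5)) + suc (4 * j + 7 * k + 5 + (4 * j + 7 * k + 5) + r)))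
  eq = solve-∀

finish₁ : ∀ g ε → 3 * (2 * cyc-len g + 1) ≤ ε → Labels [ cyc-len g ] 0 (2 * cyc-len g + 1) ε
finish₁ g ε le = _ , _ , trans (sym (m+[n∸m]≡n le)) (eq g r) ,
  widen (by (g + 4) (eq′ g)) (extend G (suc (G + G + (5 * g + 8 + r))) (λ e → m≢1+m+n (G + G) (sym e)) (one-cycle g 0 z≤n))
  where
  G = 2 + g + 0
  r = ε ∸ 3 * (2 * cyc-len g + 1)
  eq : ∀ g r → 3 * (2 * (3 + g * 2) + 1) + r ≡
    3 + (g * 3 + (suc (2 + g + 0 + (2 + g + 0)) + suc (2 + g + 0 + (2 + g + 0) + (5 * g + 8 + r))))
  eq = solve-∀
  eq′ : ∀ g → 3 + g * 3 + (g + 4) ≡ 2 * (3 + g * 2) + 1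
  eq′ = solve-∀

-- Starting points of the recursion

second-cycle′ : ∀ j c → 4 * j + c ≢ 3 → Stage (j + c) (7 * (2 * cyc-len (j + c) + 1)) (cyc-len j ∷ [ cyc-len (j + c) ]) 0
second-cycle′ j c ≢3 = stage j (g + 2)
  -- Choosing the end 2 + g + j of the wound labeling makes k = g + 2 independent of j; the size
  -- equation then gives c + 7.
  (advance j (g + 2) (c + 7) (q₁ j c) r≢ (by (7 * j + 14 * c + 9) (q₂ j c))
    (widen (by (25 * g + 46) (q₃ g)) (relabel refl (q₄ j g) (one-cycle g j (m≤m+n j c)))))
  (≤-trans (m≤m+n g 2) (m≤n+m (g + 2) j))
  (by (7 * j + 34 * c + 7) (q₅ j c))
  (by (114 * j + 714 * c + 112) (q₆ j c))
  where
  g = j + c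
  q₁ : ∀ j c → (j + c) * 3 + (c + 7) + j + 1 ≡ 4 * (j + c + 2)
  q₁ = solve-∀
  q₂ : ∀ j c → 7 * j + 14 * (j + c + 2) + 12 + (7 * j + 14 * c + 9) ≡ 7 * (2 * (3 + (j + c) * 2) + 1)
  q₂ = solve-∀
  q₃ : ∀ g → 3 + g * 3 + (25 * g + 46) ≡ 7 * (2 * (3 + g * 2) + 1)
  q₃ = solve-∀
  q₄ : ∀ j g → 2 + g + j ≡ j + (g + 2)
  q₄ = solve-∀
  q₅ : ∀ j c → 27 * j + 50 * (j + c + 2) + 40 + (7 * j + 34 * c + 7) ≡ 3 * (7 * (2 * (3 + (j + c) * 2) + 1))
  q₅ = solve-∀
  q₆ : ∀ j c → 150 * (4 * j + 7 * (j + c + 2) + 5) + 125 + (114 * j + 714 * c + 112) ≡ 63 * (7 * (2 * (3 + (j + c) * 2) + 1))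
  q₆ = solve-∀
  r≢ : c + 7 ≢ j + (g + 2) + (j + (g + 2))
  r≢ eq = ≢3 (sym (+-cancelʳ-≡ (c + 4) 3 (4 * j + c) (trans (q₇ c) (trans eq (q₈ j c)))))
    where
    q₇ : ∀ c → 3 + (c + 4) ≡ c + 7
    q₇ = solve-∀
    q₈ : ∀ j c → j + (j + c + 2) + (j + (j + c + 2)) ≡ 4 * j + c + (c + 4)
    q₈ = solve-∀

-- For j = 0 and c = 3 the end at 2 + g + j is excluded by extend, so another one is used.
second-cycle : ∀ j c → Stage (j + c) (7 * (2 * cyc-len (j + c) + 1)) (cyc-len j ∷ [ cyc-len (j + c) ]) 0
second-cycle j c with 4 * j + c ≟ 3
... | no ≢3 = second-cycle′ j c ≢3
second-cycle zero .3 | yes refl = stage 0 6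
  (advance 0 6 14 refl (λ ()) (≤ᵇ⇒≤ 96 133 _) (widen (≤ᵇ⇒≤ 12 133 _) (one-cycle 3 1 (s≤s z≤n))))
  (≤ᵇ⇒≤ 3 6 _) (≤ᵇ⇒≤ 340 399 _) (≤ᵇ⇒≤ 7175 8379 _)
second-cycle (suc j) c | yes eq = contradiction (trans (sym (lem j c)) eq) (λ ())
  where
  lem : ∀ j c → 4 * suc j + c ≡ 4 + (4 * j + c)
  lem = solve-∀

-- Both ends of the path are offered: inserting a triangle starts from the end 1, inserting a
-- 5-cycle from the end 3.
six : State [] 1 3 3 1 × State [] 1 3 3 3
six = with-path P , with-path (rev P)
  where
  P : Path 1 3 (1 ∷ 6 ∷ 0 ∷ 4 ∷ 3 ∷ []) (5 ∷ 6 ∷ 4 ∷ 1 ∷ [])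
  P = inj₁ refl ◂ (inj₂ refl ◂ (inj₁ refl ◂ (inj₂ refl ◂ point 3)))
  with-path : ∀ {x y} → Path x y (1 ∷ 6 ∷ 0 ∷ 4 ∷ 3 ∷ []) (5 ∷ 6 ∷ 4 ∷ 1 ∷ []) → State [] 1 3 3 x
  with-path P = state (two {2} {5} (inj₁ refl)) P
    (↭-solve 7 (λ a b c d e f g → a ⊕ b ⊕ c ⊕ d ⊕ e ⊕ f ⊕ g ⊜ e ⊕ c ⊕ a ⊕ g ⊕ f ⊕ b ⊕ d) ↭-refl
      [ 2 ] [ 5 ] [ 1 ] [ 6 ] [ 0 ] [ 4 ] [ 3 ])
    (↭-solve 6 (λ a b c d e f → a ⊕ b ⊕ c ⊕ d ⊕ e ⊕ f ⊜ f ⊕ a ⊕ b ⊕ e ⊕ c ⊕ d) ↭-refl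
      [ 3 ] [ 3 ] [ 5 ] [ 6 ] [ 4 ] [ 1 ])
    (≤-refl ∷ ≤-refl ∷ [])

seven : State [] 1 3 4 1
seven = state (two {2} {5} (inj₁ refl))
  (inj₁ refl ◂ (inj₂ refl ◂ (inj₁ refl ◂ (inj₂ refl ◂ (inj₁ refl ◂ point 4)))))
  (↭-solve 8 (λ a b c d e f g h → a ⊕ b ⊕ c ⊕ d ⊕ e ⊕ f ⊕ g ⊕ h ⊜ e ⊕ c ⊕ a ⊕ g ⊕ h ⊕ b ⊕ d ⊕ f) ↭-refl
    [ 2 ] [ 5 ] [ 1 ] [ 6 ] [ 0 ] [ 7 ] [ 3 ] [ 4 ])
  (↭-solve 7 (λ a b c d e f g → a ⊕ b ⊕ c ⊕ d ⊕ e ⊕ f ⊕ g ⊜ g ⊕ a ⊕ b ⊕ f ⊕ c ⊕ d ⊕ e) ↭-refl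
    [ 3 ] [ 3 ] [ 5 ] [ 6 ] [ 7 ] [ 4 ] [ 1 ])
  (≤-refl ∷ ≤-refl ∷ [])

-- Extending `six` at g = 1 misses only ε = 11, which is reached from `seven`.
two-cycle : ∀ r → State [] 1 3 (6 + r) 1
two-cycle r with r ≟ 2
... | yes refl = extend 1 1 (λ ()) seven
... | no r≢2 = extend 1 r r≢2 (proj₁ six)

two-cycle-start : ∀ g → Stage g (7 * (2 * cyc-len g + 1)) [ cyc-len g ] 1
two-cycle-start 0 = stage 0 1 (advance 0 1 0 refl (λ ()) (≤ᵇ⇒≤ 26 49 _) (widen (≤ᵇ⇒≤ 3 49 _) (proj₁ six)))
  z≤n (≤ᵇ⇒≤ 90 147 _) (≤ᵇ⇒≤ 1925 3087 _)
two-cycle-start 1 = stage 1 2 (advance 1 2 3 refl (λ ()) (≤ᵇ⇒≤ 47 77 _) (widen (≤ᵇ⇒≤ 3 77 _) (proj₂ six)))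
  (≤ᵇ⇒≤ 1 3 _) (≤ᵇ⇒≤ 167 231 _) (≤ᵇ⇒≤ 3575 4851 _)
-- On ε = 2g + 3 the end 1 reflects to 2g + 2 = j + k with j = g, and g + 7 solves the size
-- equation. It equals the exceptional value 4g + 4 just for g = 1, and `odd-label` supplies these
-- sizes from g = 2 on; hence the two separate cases.
two-cycle-start (suc (suc i)) = stage g (g + 2)
  (advance g (g + 2) (g + 7) (q₁ g) r≢ (by (7 * g + 9) (q₂ g)) (widen (by (28 * g + 46) (q₃ g)) S))
  (m≤m+n g (g + 2)) (by (7 * g + 7) (q₄ g)) (by (114 * g + 112) (q₅ g))
  where
  g = 2 + i
  odd-label : ∀ i → State [] 1 3 (2 * (2 + i)) 1
  odd-label zero    = seven
  odd-label (suc i) = relabel (eq i) refl (two-cycle (2 * i))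
    where
    eq : ∀ i → 6 + 2 * i ≡ 2 * (3 + i)
    eq = solve-∀
  S : State [] 1 3 (2 * g) (g + (g + 2))
  S = mirrorS (g + (g + 2)) (eq g) (odd-label i)
    where
    eq : ∀ g → 1 + (g + (g + 2)) ≡ 3 + 2 * g
    eq = solve-∀
  q₁ : ∀ g → 2 * g + (g + 7) + g + 1 ≡ 4 * (g + 2)
  q₁ = solve-∀
  q₂ : ∀ g → 7 * g + 14 * (g + 2) + 12 + (7 * g + 9) ≡ 7 * (2 * (3 + g * 2) + 1)
  q₂ = solve-∀
  q₃ : ∀ g → 3 + (28 * g + 46) ≡ 7 * (2 * (3 + g * 2) + 1)
  q₃ = solve-∀
  q₄ : ∀ g → 27 * g + 50 * (g + 2) + 40 + (7 * g + 7) ≡ 3 * (7 * (2 * (3 + g * 2) + 1))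
  q₄ = solve-∀
  q₅ : ∀ g → 150 * (4 * g + 7 * (g + 2) + 5) + 125 + (114 * g + 112) ≡ 63 * (7 * (2 * (3 + g * 2) + 1))
  q₅ = solve-∀
  r≢ : g + 7 ≢ g + (g + 2) + (g + (g + 2))
  r≢ eq = contradiction (+-cancelˡ-≡ (9 + i) 0 (3 + 3 * i) (trans (q₆ i) (trans eq (q₇ i)))) (λ ())
    where
    q₆ : ∀ i → 9 + i + 0 ≡ 2 + i + 7
    q₆ = solve-∀
    q₇ : ∀ i → 2 + i + (2 + i + 2) + (2 + i + (2 + i + 2)) ≡ 9 + i + (3 + 3 * i)
    q₇ = solve-∀

only-path : ∀ r → State [] 0 3 (2 + r) 0
only-path r = extend 0 (suc r) (λ ()) (state none
  (inj₁ {B = 3 + 3 ≡ 0} refl ◂ (inj₂ refl ◂ (inj₁ refl ◂ point 2)))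
  (↭-solve 4 (λ a b c d → a ⊕ b ⊕ c ⊕ d ⊜ a ⊕ c ⊕ d ⊕ b) ↭-refl [ 0 ] [ 3 ] [ 1 ] [ 2 ])
  (↭-solve 3 (λ a b c → a ⊕ b ⊕ c ⊜ c ⊕ b ⊕ a) ↭-refl [ 3 ] [ 2 ] [ 1 ]) [])

-- Arbitrary multisets of odd lengths

-- The recursion yields the cycles in order of insertion, while the labeling must list them in the
-- order of the given L.
Core-↭ : ∀ {L L′ V D} → L ↭ L′ → Core L a V D → ∃₂ λ V′ D′ → Core L′ a V′ D′ × V′ ↭ V × D′ ↭ D
Core-↭ Perm.refl C = _ , _ , C , ↭-refl , ↭-refl
Core-↭ (Perm.prep _ e) (cyc {V = V} {D = D} {κ = κ} w δ len C) with Core-↭ e C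
... | _ , _ , C′ , v , d = _ , _ , cyc w δ len C′ , ++⁺ˡ V v , prep κ (++⁺ˡ D d)
Core-↭ (Perm.swap _ _ e) (cyc {V = V} {D = D} {κ = κ} w δ len (cyc {V = V′} {D = D′} {κ = κ′} w′ δ′ len′ C)) with Core-↭ e C
... | V″ , D″ , C′ , v , d = _ , _ , cyc w′ δ′ len′ (cyc w δ len C′) ,
  ↭-trans (↭-solve 3 (λ a b c → a ⊕ b ⊕ c ⊜ b ⊕ a ⊕ c) ↭-refl V′ V V″) (++⁺ˡ V (++⁺ˡ V′ v)) ,
  ↭-trans (↭-solve 5 (λ k′ d′ k d r → k′ ⊕ d′ ⊕ k ⊕ d ⊕ r ⊜ k ⊕ d ⊕ k′ ⊕ d′ ⊕ r) ↭-refl [ κ′ ] D′ [ κ ] D D″)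
    (prep κ (++⁺ˡ D (prep κ′ (++⁺ˡ D′ d))))
Core-↭ (Perm.trans e e′) C with Core-↭ e C
... | _ , _ , C₁ , v₁ , d₁ with Core-↭ e′ C₁
... | _ , _ , C₂ , v₂ , d₂ = _ , _ , C₂ , ↭-trans v₂ v₁ , ↭-trans d₂ d₁

reorder : ∀ {L′} → L ↭ L′ → Labels L a X n → Labels L′ a X n
reorder e (n , p , eq , state {VP = VP} {DP} C P v d b) with Core-↭ e C
... | _ , _ , C′ , v′ , d′ = n , p , eq ,
  state C′ P (↭-trans (++⁺ʳ VP v′) v) (↭-trans (++⁺ʳ DP d′) d) (All-resp-↭ (↭-sym d′) b)

odd-lengths : ∀ L → All (λ ℓ → ¬ (2 ∣ ℓ) × 1 < ℓ) L → ∃ λ js → map cyc-len js ≡ L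
odd-lengths [] [] = [] , refl
odd-lengths (ℓ ∷ L) ((odd , 1<ℓ) ∷ ps) with parityView ℓ | odd-lengths L ps
... | evenP t       | _ = contradiction (divides t (trans (cong (_+_ t) (sym (+-identityʳ t))) (*-comm 2 t))) odd
... | oddP zero     | _ = contradiction 1<ℓ (<-irrefl refl)
... | oddP (suc j) | js , eq = j ∷ js , cong₂ _∷_ (lem j) eq
  where
  lem : ∀ j → 3 + j * 2 ≡ suc (suc j + suc j)
  lem = solve-∀

cyc-len-mono : ∀ {i j} → i ≤ j → cyc-len i ≤ cyc-len j
cyc-len-mono i≤j = +-monoʳ-≤ 3 (*-monoˡ-≤ 2 i≤j)

longest : ∀ j js → ∃₂ λ g R → j ∷ js ↭ g ∷ R × All (_≤ g) R × maxL (map cyc-len (j ∷ js)) ≡ cyc-len g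
longest j [] = j , [] , ↭-refl , [] , ⊔-identityʳ (cyc-len j)
longest j (j′ ∷ js) with longest j′ js
... | g , R , e , ps , eq with ≤-total j g
... | inj₁ j≤g = g , j ∷ R , ↭-trans (prep j e) (swap j g ↭-refl) , j≤g ∷ ps ,
  trans (cong (cyc-len j ⊔_) eq) (m≤n⇒m⊔n≡n (cyc-len-mono j≤g))
... | inj₂ g≤j = j , j′ ∷ js , ↭-refl , All-resp-↭ (↭-sym e) (g≤j ∷ All.map (λ h → ≤-trans h g≤j) ps) ,
  trans (cong (cyc-len j ⊔_) eq) (m≥n⇒m⊔n≡m (cyc-len-mono g≤j))

-- The exponent counts insertions. The starting object, the longest cycle or for a = 1 the 2-cycle,
-- costs no factor; every further cycle costs a factor 7.
build : ∀ g R → All (_≤ g) R → a ≤ 1 → ∀ ε → 3 * (7 ^ (length R + a) * (2 * cyc-len g + 1)) ≤ ε →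
        Labels (map cyc-len (g ∷ R)) a (7 ^ (length R + a) * (2 * cyc-len g + 1)) ε
build g [] _ z≤n ε le = subst (λ X → Labels [ cyc-len g ] 0 X ε) (sym (*-identityˡ (2 * cyc-len g + 1)))
  (finish₁ g ε (subst (λ X → 3 * X ≤ ε) (*-identityˡ (2 * cyc-len g + 1)) le))
build g (j ∷ R) (j≤g ∷ ps) z≤n ε le = result (g ∸ j) (m+[n∸m]≡n j≤g)
  where
  E = 2 * cyc-len g + 1
  X≡ : 7 ^ length R * (7 * E) ≡ 7 ^ (suc (length R) + 0) * E
  X≡ = trans (7*-assoc (7 ^ length R) E) (cong (λ l → 7 ^ l * E) (sym (+-identityʳ (suc (length R)))))
  result : ∀ c → j + c ≡ g → Labels (map cyc-len (g ∷ j ∷ R)) 0 (7 ^ (suc (length R) + 0) * E) ε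
  result c j+c = reorder (↭-trans (proj₁ (proj₂ S)) (↭-trans (++-comm (map cyc-len R) _) (swap _ _ ↭-refl)))
    (finish ε le (subst (λ X → Stage g X (proj₁ S) 0) X≡ (proj₂ (proj₂ S))))
    where
    S : ∃ λ L′ → L′ ↭ map cyc-len R ++ cyc-len j ∷ [ cyc-len g ] × Stage g (7 ^ length R * (7 * E)) L′ 0
    S = chain R ps (subst (λ g → Stage g (7 * (2 * cyc-len g + 1)) (cyc-len j ∷ [ cyc-len g ]) 0) j+c (second-cycle j c))
build g R ps (s≤s z≤n) ε le = reorder (↭-trans (proj₁ (proj₂ S)) (++-comm (map cyc-len R) _))
  (finish ε le (subst (λ X → Stage g X (proj₁ S) 1) X≡ (proj₂ (proj₂ S))))
  where
  E = 2 * cyc-len g + 1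
  X≡ : 7 ^ length R * (7 * E) ≡ 7 ^ (length R + 1) * E
  X≡ = trans (7*-assoc (7 ^ length R) E) (cong (λ l → 7 ^ l * E) (+-comm 1 (length R)))
  S : ∃ λ L′ → L′ ↭ map cyc-len R ++ [ cyc-len g ] × Stage g (7 ^ length R * (7 * E)) L′ 1
  S = chain R ps (two-cycle-start g)

labels : ∀ js → a ≤ 1 → ∀ ε → 3 * ε₁ (map cyc-len js) a ≤ ε → Labels (map cyc-len js) a (ε₁ (map cyc-len js) a) ε
labels [] z≤n ε le = _ , _ , sym (m+[n∸m]≡n le) , only-path (4 + (ε ∸ 9))
labels [] (s≤s z≤n) ε le = _ , _ , sym (m+[n∸m]≡n le) , two-cycle (ε ∸ 9)
labels {a} (j ∷ js) a≤1 ε le with longest j js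
... | g , R , e , ps , eq = reorder (↭-sym (map⁺ cyc-len e))
  (subst (λ X → Labels (map cyc-len (g ∷ R)) a X ε) X≡ (build g R ps a≤1 ε (subst (λ X → 3 * X ≤ ε) (sym X≡) le)))
  where
  X≡ : 7 ^ (length R + a) * (2 * cyc-len g + 1) ≡ ε₁ (map cyc-len (j ∷ js)) a
  X≡ = cong₂ (λ l m → 7 ^ (l + a) * (2 * m + 1))
    (trans (suc-injective (↭-length (↭-sym e))) (sym (length-map cyc-len js))) (sym eq)

-- The lengths in `base` are at most 3, so those above ε₁ all lie in the regular range `rng 4 n`.
3≤ε₁ : ∀ js a → 3 ≤ ε₁ (map cyc-len js) a
3≤ε₁ [] a = ≤-refl
3≤ε₁ (j ∷ js) a = *-mono-≤ (m^n>0 7 (length (map cyc-len js) + a))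
  (+-monoˡ-≤ 1 (*-monoʳ-≤ 2 (≤-trans (s≤s z≤n) (m≤m⊔n (cyc-len j) (maxL (map cyc-len js))))))

-- Integer labelings

-- With A the lengths on the cycles and T those above the bound, this places all of T on the path.
split-large : ∀ {A B S : List ℕ} T → All (_≤ X) A → All (X <_) T → A ++ B ↭ T ++ S → ∃ λ R → B ↭ T ++ R
split-large {B = B} [] _ _ _ = B , ↭-refl
split-large {A = A} {B} (t ∷ T) A≤ (t> ∷ T>) e with ∈-++⁻ A (∈-resp-↭ (↭-sym e) (here refl))
... | inj₁ t∈A = contradiction (All.lookup A≤ t∈A) (<⇒≱ t>)
... | inj₂ t∈B with ∈-∃++ t∈B
... | B₁ , B₂ , refl with split-large {A = A} {B₁ ++ B₂} T A≤ T>
        (drop-∷ (↭-trans (↭-sym (shift t A (B₁ ++ B₂))) (↭-trans (++⁺ˡ A (↭-sym (shift t B₁ B₂))) e)))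
... | R , r = R , ↭-trans (shift t B₁ B₂) (prep t r)

±-++ : ∀ xs {ys} → ± (xs ++ ys) ≡ ± xs ++ ± ys
±-++ []       = refl
±-++ (x ∷ xs) = cong (λ zs → x ∷ ℤ.- x ∷ zs) (±-++ xs)

±-↭ : ∀ {xs ys} → xs ↭ ys → ± xs ↭ ± ys
±-↭ Perm.refl         = ↭-refl
±-↭ (Perm.prep x e)   = prep _ (prep _ (±-↭ e))
±-↭ (Perm.swap {xs} {ys} x y e) =
  ↭-trans (prep x (prep (ℤ.- x) (prep y (prep (ℤ.- y) (±-↭ e)))))
          (++⁺ʳ (± ys) (++-comm (x ∷ ℤ.- x ∷ []) (y ∷ ℤ.- y ∷ [])))
±-↭ (Perm.trans e e′) = ↭-trans (±-↭ e) (±-↭ e′)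

±-contains : ∀ xs → ∃ λ ys → ± xs ↭ xs ++ ys
±-contains []       = [] , ↭-refl
±-contains (x ∷ xs) with ±-contains xs
... | ys , e = ℤ.- x ∷ ys , prep x (↭-trans (prep (ℤ.- x) e) (↭-sym (shift (ℤ.- x) xs ys)))

Δedges-++ : ∀ es {fs} → Δedges (es ++ fs) ≡ Δedges es ++ Δedges fs
Δedges-++ []             = refl
Δedges-++ ((u , w) ∷ es) = cong (λ zs → u ℤ.- w ∷ w ℤ.- u ∷ zs) (Δedges-++ es)

diff : ∀ x d → + (x + d) ℤ.- + x ≡ + d
diff x d = trans (ℤ.m-n≡m⊖n (x + d) x) (trans (ℤ.⊖-≥ (m≤m+n x d)) (cong +_ (m+n∸m≡n x d)))

diff′ : ∀ x d → + x ℤ.- + (x + d) ≡ ℤ.- + d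
diff′ x d = trans (sym (ℤ.neg-involutive _)) (cong ℤ.-_ (trans (lem (+ x) (+ (x + d))) (diff x d)))
  where
  lem : ∀ i j → ℤ.- (i ℤ.- j) ≡ j ℤ.- i
  lem i j = trans (ℤ.neg-distrib-+ i (ℤ.- j)) (trans (cong (ℤ._+_ (ℤ.- i)) (ℤ.neg-involutive j)) (ℤ.+-comm (ℤ.- i) j))

Δedge : Dist x y d → ∀ {E E′ : List ℤ} → E ↭ E′ →
        + x ℤ.- + y ∷ + y ℤ.- + x ∷ E ↭ + d ∷ ℤ.- + d ∷ E′
Δedge {x} {d = d} (inj₁ refl) e rewrite diff x d | diff′ x d = Perm.swap _ _ e
Δedge {y = y} {d} (inj₂ refl) e rewrite diff y d | diff′ y d = prep _ (prep _ e)

Walk-Δ : Walk x y V D → Δedges (pathEdges (map +_ V)) ↭ ± (map +_ D)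
Walk-Δ (pt _) = ↭-refl
Walk-Δ (cons δ w@(pt _))     = Δedge δ (Walk-Δ w)
Walk-Δ (cons δ w@(cons _ _)) = Δedge δ (Walk-Δ w)

cycleEdges-Walk : Walk x y V D → cycleEdges (map +_ V) ≡ pathEdges (map +_ (V ++ [ x ]))
cycleEdges-Walk (pt _) = refl
cycleEdges-Walk {x} (cons {V = V} _ _) = cong (λ zs → pathEdges (+ x ∷ zs)) (sym (map-++ +_ V [ x ]))

-- The closing edge, followed by the single point x, turns the walk into the closed vertex list that
-- `cycleEdges` traverses.
cycle-Δ : Walk x y V D → Dist y x κ → Δedges (cycleEdges (map +_ V)) ↭ ± (map +_ (κ ∷ D))
cycle-Δ {D = D} {κ} w δ = ↭-trans (↭-reflexive (cong Δedges (cycleEdges-Walk w)))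
  (↭-trans (Walk-Δ (Walk-join w δ (pt _))) (±-↭ (map⁺ +_ (++-comm D [ κ ]))))

-- The 2-cycle is kept apart because Labeling.vertices reduces only for a known list of 2-cycles.
realize : Core L a V D → ∃ λ cs → Pointwise (λ ℓ c → length c ≡ ℓ) L cs × (∃₂ λ V₂ D₂ → Core [] a V₂ D₂ ×
          concat cs ++ map +_ V₂ ≡ map +_ V × Δedges (concatMap cycleEdges cs) ++ ± (map +_ D₂) ↭ ± (map +_ D))
realize none    = [] , [] , _ , _ , none , refl , ↭-refl
realize (two δ) = [] , [] , _ , _ , two δ , refl , ↭-refl
realize (cyc {V = V} {D = D} {κ = κ} {V′ = V′} {D′ = D′} w δ len C) with realize C
... | cs , ls , V₂ , D₂ , C₂ , v , e =
  map +_ V ∷ cs , trans (length-map +_ V) len ∷ ls , V₂ , D₂ , C₂ ,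
  trans (++-assoc (map +_ V) (concat cs) _) (trans (cong (map +_ V ++_) v) (sym (map-++ +_ V V′))) ,
  ↭-trans (↭-reflexive (trans (cong (_++ ± (map +_ D₂)) (Δedges-++ (cycleEdges (map +_ V)))) (++-assoc (Δedges (cycleEdges (map +_ V))) _ _)))
    (↭-trans (++-cong (cycle-Δ w δ) e)
      (↭-reflexive (trans (sym (±-++ (map +_ (κ ∷ D)))) (cong ± (sym (map-++ +_ (κ ∷ D) D′))))))

rng-I : ∀ s t → map +_ (rng s (suc t ∸ s)) ≡ I s t
rng-I s t = sym (trans (map-upTo (λ k → + (s + k)) (suc t ∸ s)) (go (suc t ∸ s) s λ _ → refl))
  where
  go : ∀ n s {f : ℕ → ℤ} → (∀ k → f k ≡ + (s + k)) → applyUpTo f n ≡ map +_ (rng s n)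
  go zero    s h = refl
  go (suc n) s h = cong₂ _∷_ (trans (h 0) (cong +_ (+-identityʳ s))) (go n (suc s) λ k → trans (h (suc k)) (cong +_ (+-suc s k)))

Core-length : Core L a V D → length V ≡ sum L + 2 * a
Core-length none    = refl
Core-length (two _) = refl
Core-length {L = ℓ ∷ L} {a} (cyc {V = V} _ _ len C) =
  trans (length-++ V) (trans (cong₂ _+_ len (Core-length C)) (sym (+-assoc ℓ (sum L) (2 * a))))

Walk-length : Walk x y V D → length V ≡ suc (length V ∸ 1)
Walk-length (pt _)     = refl
Walk-length (cons _ _) = refl

rng-≥ : ∀ s n → All (s ≤_) (rng s n)
rng-≥ s zero    = []
rng-≥ s (suc n) = ≤-refl ∷ All.map (λ h → ≤-trans (n≤1+n s) h) (rng-≥ (suc s) n)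

-- Matching on the remaining core fixes a, and with it the 2-cycles and the target. The hypothesis
-- `Δ` is quantified over `es` because the edges following the odd cycles are known only then.
assemble : ∀ {V₂ D₂} cs path → Pointwise (λ ℓ c → length c ≡ ℓ) L cs → Core [] a V₂ D₂ →
  length path ≡ suc (3 + n ∸ (sum L + 2 * a)) → concat cs ++ map +_ V₂ ++ path ↭ I 0 (3 + n) →
  (∀ es → Δedges es ↭ ± (map +_ D₂) ++ Δedges (pathEdges path) →
    Δedges (concatMap cycleEdges cs ++ es) ↭ ± (map +_ (base a ++ rng 4 n))) →
  Δedges (pathEdges path) ⊇ₘ I X (3 + n) →
  Σ (Labeling L a (3 + n ∸ (sum L + 2 * a))) λ Γ → Graceful (3 + n) Γ × (Labeling.Δp Γ ⊇ₘ I X (3 + n))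
assemble {n = n} cs path ls none len verts Δ sup =
  record { cycles = cs ; cycle-len = ls ; twos = [] ; twos-len = refl ; path = path ; path-len = len } ,
  (verts , ↭-trans (Δ (pathEdges path) ↭-refl) (↭-reflexive (cong ± (rng-I 1 (3 + n))))) , sup
assemble {n = n} cs path ls (two {u} {w} δ) len verts Δ sup =
  record { cycles = cs ; cycle-len = ls ; twos = [ (+ u , + w) ] ; twos-len = refl ; path = path ; path-len = len } ,
  (verts , ↭-trans (Δ ((+ u , + w) ∷ (+ u , + w) ∷ pathEdges path) (Δedge δ (Δedge δ ↭-refl)))
    (↭-reflexive (cong (λ E → ± (+ 1 ∷ + 3 ∷ + 3 ∷ []) ++ ± E) (rng-I 4 (3 + n))))) , sup

realized : 3 ≤ X → X ≤ 3 + n → State L a X n p →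
           Σ (Labeling L a (3 + n ∸ (sum L + 2 * a))) λ Γ → Graceful (3 + n) Γ × (Labeling.Δp Γ ⊇ₘ I (X + 1) (3 + n))
realized {suc (suc (suc x))} {n} {L} {a} (s≤s (s≤s (s≤s _))) (s≤s (s≤s (s≤s x≤n)))
  (state {VC} {DC} {VP} {DP} C (V′ , D′ , w , v , e) verts diffs bound) = with-core (realize C)
  where
  X′ = 3 + x
  path = map +_ V′

  path-len : length path ≡ suc (3 + n ∸ (sum L + 2 * a))
  path-len = trans (length-map +_ V′) (trans (Walk-length w) (cong suc (sym (m≡a+b⇒m∸a≡b (sum L + 2 * a) m total))))
    where
    m = length V′ ∸ 1
    total : 3 + n ≡ sum L + 2 * a + m
    total = suc-injective (trans (sym (trans (↭-length verts) (length-rng 0 (4 + n))))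
      (trans (length-++ VC) (trans (cong₂ _+_ (Core-length C) (trans (sym (↭-length v)) (Walk-length w))) (+-suc _ m))))

  pathΔ : Δedges (pathEdges path) ↭ ± (map +_ DP)
  pathΔ = ↭-trans (Walk-Δ w) (±-↭ (map⁺ +_ e))

  large : ∃ λ R → DP ↭ rng (suc X′) (n ∸ x) ++ R
  large = split-large (rng (suc X′) (n ∸ x)) bound (rng-≥ (suc X′) (n ∸ x)) (↭-trans diffs
    (↭-trans (++⁺ˡ (base a) (↭-reflexive (trans (cong (rng 4) (sym (m+[n∸m]≡n x≤n))) (sym (rng-++ {4} x (n ∸ x) refl)))))
      (↭-trans (↭-reflexive (sym (++-assoc (base a) (rng 4 x) (rng (suc X′) (n ∸ x))))) (++-comm (base a ++ rng 4 x) (rng (suc X′) (n ∸ x))))))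

  path⊇ : Δedges (pathEdges path) ⊇ₘ I (X′ + 1) (3 + n)
  path⊇ with large
  ... | R , r with ±-contains (map +_ (rng (suc X′) (n ∸ x) ++ R))
  ... | ys , f = map +_ R ++ ys , ↭-trans pathΔ (↭-trans (±-↭ (map⁺ +_ r)) (↭-trans f (↭-reflexive
    (trans (cong (_++ ys) (map-++ +_ (rng (suc X′) (n ∸ x)) R))
    (trans (++-assoc (map +_ (rng (suc X′) (n ∸ x))) (map +_ R) ys)
      (cong (_++ map +_ R ++ ys) (trans (rng-I (suc X′) (3 + n)) (cong (λ s → I s (3 + n)) (+-comm 1 X′)))))))))

  with-core : (∃ λ cs → Pointwise (λ ℓ c → length c ≡ ℓ) L cs × (∃₂ λ V₂ D₂ → Core [] a V₂ D₂ ×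
            concat cs ++ map +_ V₂ ≡ map +_ VC × Δedges (concatMap cycleEdges cs) ++ ± (map +_ D₂) ↭ ± (map +_ DC))) →
           Σ (Labeling L a (3 + n ∸ (sum L + 2 * a))) λ Γ → Graceful (3 + n) Γ × (Labeling.Δp Γ ⊇ₘ I (X′ + 1) (3 + n))
  with-core (cs , ls , V₂ , D₂ , C₂ , eV , eΔ) = assemble cs path ls C₂ path-len all-verts all-Δ path⊇
    where
    all-verts : concat cs ++ map +_ V₂ ++ path ↭ I 0 (3 + n)
    all-verts = ↭-trans (↭-reflexive (trans (sym (++-assoc (concat cs) (map +_ V₂) path))
      (trans (cong (_++ path) eV) (sym (map-++ +_ VC V′)))))
      (↭-trans (map⁺ +_ (↭-trans (++⁺ˡ VC v) verts)) (↭-reflexive (rng-I 0 (3 + n))))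

    all-Δ : ∀ es → Δedges es ↭ ± (map +_ D₂) ++ Δedges (pathEdges path) →
            Δedges (concatMap cycleEdges cs ++ es) ↭ ± (map +_ (base a ++ rng 4 n))
    all-Δ es e′ = ↭-trans (↭-reflexive (Δedges-++ (concatMap cycleEdges cs)))
      (↭-trans (++⁺ˡ (Δedges (concatMap cycleEdges cs)) e′)
      (↭-trans (↭-reflexive (sym (++-assoc (Δedges (concatMap cycleEdges cs)) _ _)))
      (↭-trans (++-cong eΔ pathΔ)
      (↭-trans (↭-reflexive (trans (sym (±-++ (map +_ DC))) (cong ± (sym (map-++ +_ DC DP)))))
        (±-↭ (map⁺ +_ diffs))))))

theorem5p8 : (L : List ℕ) → All (λ ℓ → ¬ (2 ∣ ℓ) × 1 < ℓ) L →
    (a : ℕ) → a ≤ 1 →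
    (ε : ℕ) → 3 * ε₁ L a ≤ ε →
    Σ (Labeling L a (ε ∸ (sum L + 2 * a))) λ Γ →
    Graceful ε Γ × (Labeling.Δp Γ ⊇ₘ I (ε₁ L a + 1) ε)
theorem5p8 L odds a a≤1 ε le with odd-lengths L odds
... | js , refl with labels js a≤1 ε le
... | n , p , refl , S = realized (3≤ε₁ js a) (≤-trans (m≤m+n _ _) le) S
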